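{- Let $p \neq 2,5$ be a prime, let $a, n$ be positive integers, and let $r = p^a n \bmod z(p)$, $s = n \bmod z(p)$, and $A = \left\lfloor \frac{n(p^a - 1)}{p^{\nu_p (n)}z(p)} \right\rfloor$. Then: (i) If $p \equiv \pm 1 \pmod{5}$, then $$\nu_p \left( {p^a n \choose n}_F \right) = \frac{A}{p-1} - a\left\{ \frac{n}{p^{\nu_p (n)}z(p)} \right\} - \nu_p (A!) = \frac{s_p (A)}{p - 1} - a\left\{ \frac{n}{p^{\nu_p (n)}z(p)} \right\}.$$ (ii) If $p \equiv \pm 2 \pmod{5}$ and $a$ is even, then $$\nu_p \left( {p^a n \choose n}_F \right) = \frac{A}{p-1} - \frac{a}{2}[s \neq 0] - \nu_p (A!) = \frac{s_p (A)}{p - 1} - \frac{a}{2}[s \neq 0].$$ (iii) If $p \equiv \pm 2 \pmod{5}$ and $a$ is odd, then $$\nu_p \left( {p^a n \choose n}_F \right) = \left\lfloor \frac{A}{p - 1} \right\rfloor - \frac{a-1}{2}[s \neq 0] - \nu_p (A!) + \delta,$$ where $\delta = \left( \left\lfloor \frac{\nu_p (n)}{2} \right\rfloor + [2 \nmid \nu_p(n)][r>s] + [r < s]\,\nu_p(F_{z(p)}) \right)[r \neq s]$; equivalently, $\delta = 0$ if $r = s$, $\delta = \left\lfloor \frac{\nu_p (n)}{2} \right\rfloor + \nu_p (F_{z(p)})$ if $r < s$, and $\delta = \left\lceil \frac{\nu_p (n)}{2} \right\rceil$ if $r > s$.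
   Context: The Fibonacci sequence is $F_1=F_2=1$, $F_n=F_{n-1}+F_{n-2}$ for $n\ge 3$. For $m\ge 1$ and $1\le k\le m$ the Fibonomial coefficient is ${m \choose k}_F = \frac{F_1F_2\cdots F_m}{(F_1\cdots F_k)(F_1\cdots F_{m-k})}$ (an integer). $z(m)$, the rank of appearance of $m$, is the smallest positive integer $t$ with $m \mid F_t$. $\nu_p(x)$ is the exponent of $p$ in $x$; $s_p(n)$ is the sum of base-$p$ digits of $n$; $\{x\}=x-\lfloor x\rfloor$; $[P]$ is the Iverson bracket; $a \bmod m$ is the least nonnegative residue of $a$ modulo $m$. -}

module Defs where

open import Data.Nat using (ℕ; zero; suc; _+_; _*_; _∸_; _^_; _≤_; _<_; _/_; _%_)
open import Data.Nat.Divisibility using (_∣_; _∣?_)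
open import Data.Integer using (ℤ; +_)
open import Data.Rational using (ℚ; floor; _-_) renaming (_/_ to _/ℚ_)
open import Data.Bool using (Bool; true; false; if_then_else_)
open import Data.Product using (_×_)
open import Relation.Nullary using (Dec; yes; no; ¬_)

F : ℕ → ℕ
F zero = zero
F (suc zero) = 1
F (suc (suc n)) = F (suc n) + F n

fibFact : ℕ → ℕ
fibFact zero = 1
fibFact (suc m) = fibFact m * F (suc m)

-- natural-number floor division / remainder; the divisor-zero branch is never used
infixl 7 _div_ _mod_
_div_ : ℕ → ℕ → ℕ
x div zero = zero
x div suc d = x / suc d

_mod_ : ℕ → ℕ → ℕ
x mod zero = x
x mod suc d = x % suc d

fibonomial : ℕ → ℕ → ℕ
fibonomial m k = fibFact m div (fibFact k * fibFact (m ∸ k))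

IsRankOfAppearance : ℕ → ℕ → Set
IsRankOfAppearance m z = (1 ≤ z) × (m ∣ F z) × (∀ t → 1 ≤ t → t < z → ¬ (m ∣ F t))


-- p-adic valuation ν_p(x) for x ≥ 1, p ≥ 2 (fuel x suffices)
νfuel : ℕ → ℕ → ℕ → ℕ
νfuel zero p x = zero
νfuel (suc k) p zero = zero
νfuel (suc k) p (suc x) with p ∣? suc x
... | yes _ = suc (νfuel k p (suc x div p))
... | no _ = zero

ν : ℕ → ℕ → ℕ
ν p x = νfuel x p x

-- sum of base-p digits s_p(n), for p ≥ 2 (fuel n suffices)
sfuel : ℕ → ℕ → ℕ → ℕ
sfuel zero p n = zero
sfuel (suc k) p n = n mod p + sfuel k p (n div p)

sp : ℕ → ℕ → ℕ
sp p n = sfuel n p n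

[_] : ∀ {P : Set} → Dec P → ℕ
[ yes _ ] = 1
[ no _ ] = 0

-- the rational x / d (d ≠ 0 in all uses)
_÷_ : ℕ → ℕ → ℚ
x ÷ zero = + 0 /ℚ 1
x ÷ suc d = + x /ℚ suc d

frac : ℚ → ℚ
frac q = q - (floor q /ℚ 1)

{-# OPTIONS --safe #-}

-- Let E(k) = ν_p(k!), n = p^v n′ with p ∤ n′, and m = n′(p^a − 1), so that A = ⌊m/z⌋ and
-- n(p^a − 1) = p^v m.  Writing ζ for a primitive fifth root of unity, (ζ + ζ⁻¹)^p ≡ ζ^p + ζ^{−p}
-- modulo p yields p ∣ F_{p−1} when p ≡ ±1 and p ∣ F_{p+1} when p ≡ ±2 (mod 5); hence p ≡ 1,
-- respectively p ≡ −1, modulo z.  Since ν_p(F_{zk}) = ν_p(F_z) + ν_p(k), the product F_1 ⋯ F_x has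
-- valuation ν_p(F_z) ⌊x/z⌋ + E(⌊x/z⌋), and repeated use of E(k) = ⌊k/p⌋ + E(⌊k/p⌋) turns the valuation
-- of the Fibonomial coefficient into
--   ν_p(F_z) [r < s] + Σ_{i<a} ⌊p^i n/z⌋ − Σ_{i<v} ⌊p^i m/z⌋ − E(A).
-- Multiplied by z, the floors become geometric sums minus sums of residues modulo z; the residues are
-- constant if p ≡ 1 and alternate between complementary values if p ≡ −1 (mod z).
module Submission where

open import Defs
open import Data.Nat using (ℕ; zero; suc; _+_; _*_; _∸_; _^_; _≤_; _<_; _/_; _%_; _!; z≤n; s≤s; NonZero; NonTrivial; >-nonZero; ≢-nonZero⁻¹; nonTrivial⇒n>1; ⌊_/2⌋; ⌈_/2⌉)
open import Data.Nat.Properties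
open import Data.Nat.Combinatorics using (_C_; nCk≡n!/k![n-k]!; k![n∸k]!∣n!; k>n⇒nCk≡0; nCk+nC[k+1]≡[n+1]C[k+1])
open import Data.Nat.DivMod hiding (_div_; _mod_)
open import Data.Nat.Divisibility
open import Data.Nat.Primality using (Prime; euclidsLemma; prime⇒nonZero; prime⇒nonTrivial)
open import Data.Nat.Tactic.RingSolver using (solve-∀)
open import Data.Integer using (ℤ; +_; -[1+_]; 0ℤ) renaming (_+_ to _+ℤ_; _-_ to _-ℤ_)
import Data.Integer as ℤ
import Data.Integer.Divisibility.Signed as ℤᵈ
import Data.Integer.DivMod as ℤᵐ
import Data.Integer.Properties as ℤₚ
import Data.Integer.Tactic.RingSolver as ℤ-Solver
open import Data.Rational using (mkℚ; floor; toℚᵘ) renaming (_+_ to _+ℚ_; _-_ to _-ℚ_; _*_ to _*ℚ_)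
import Data.Rational as ℚ
import Data.Rational.Properties as ℚₚ
open import Data.Rational.Unnormalised using (mkℚᵘ; _≃_; *≡*)
import Data.Rational.Unnormalised as ℚᵘ
import Data.Rational.Unnormalised.Properties as ℚᵘₚ
open import Data.Product using (_×_; _,_; ∃; proj₁; proj₂)
open import Data.Sum using (_⊎_; inj₁; inj₂; [_,_]′)
open import Relation.Binary.PropositionalEquality using (_≡_; _≢_; refl; sym; trans; cong; cong₂; subst; module ≡-Reasoning)
import Relation.Binary.Reasoning.Setoid as SetoidReasoning
open import Relation.Nullary using (¬_; Dec; yes; no; contradiction; ¬?)

-- The cases differ in whether z divides p^a - 1. It does in (i) and (ii): then r = s, so the term
-- with ν_p(F_z) disappears, m / z is an integer, and all residues of the numbers p^i m are 0. If p
-- ≡ -1 modulo z and a is odd, z ∣ m can fail: one residue of the numbers p^i n stays unpaired, one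
-- of the numbers p^i m as well if v is odd, and δ records what they leave once A/(p - 1) is
-- replaced by its floor. The valuation of F_{zk} needs an expansion to second order. At k = p and
-- ν_p(F_z) = 1 the linear and the quadratic term could have the same order; what separates them is
-- that p divides p(p - 1)/2, and this is where p has to be odd. Since subtraction on ℕ truncates,
-- the identities are proved with every negative term moved to the other side, and become
-- differences in ℚ or ℤ only at the end.

-- p-adic valuations, products over blocks, and Legendre's formula.

div≡/ : ∀ x d .{{_ : NonZero d}} → x div d ≡ x / d
div≡/ x (suc d) = refl

mod≡% : ∀ x d .{{_ : NonZero d}} → x mod d ≡ x % d
mod≡% x (suc d) = refl

∤⇒nonZero : ∀ {p c} → p ∤ c → NonZero c
∤⇒nonZero {p} {zero} p∤c = contradiction (p ∣0) p∤c
∤⇒nonZero {p} {suc c} p∤c = _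

module _ {p : ℕ} (pp : Prime p) where

  private instance
    p≢0 : NonZero p
    p≢0 = prime⇒nonZero pp
    p>1 : NonTrivial p
    p>1 = prime⇒nonTrivial pp

  ∤-* : ∀ {x y} → p ∤ x → p ∤ y → p ∤ x * y
  ∤-* {x} {y} p∤x p∤y p∣xy = [ p∤x , p∤y ]′ (euclidsLemma x y pp p∣xy)

  νfuel-unique : ∀ k e {x c} → x ≡ p ^ e * c → p ∤ c → x ≤ k → νfuel k p x ≡ e
  νfuel-unique k e {zero} {c} eq p∤c _ =
    contradiction (sym eq) (m*n≢0⇒ (p ^ e) c {{m^n≢0 p e}} {{∤⇒nonZero p∤c}})
    where
    m*n≢0⇒ : ∀ m n .{{_ : NonZero m}} .{{_ : NonZero n}} → m * n ≢ 0
    m*n≢0⇒ (suc m) (suc n) ()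
  νfuel-unique (suc k) e {suc x} {c} eq p∤c (s≤s x≤k) with p ∣? suc x
  νfuel-unique (suc k) zero {suc x} {c} eq p∤c (s≤s x≤k) | yes p∣x =
    contradiction (subst (p ∣_) (trans eq (*-identityˡ c)) p∣x) p∤c
  νfuel-unique (suc k) (suc e) {suc x} {c} eq p∤c (s≤s x≤k) | yes p∣x =
    cong suc (νfuel-unique k e quot p∤c (≤-trans bound x≤k))
    where
    quot : suc x div p ≡ p ^ e * c
    quot = begin
      suc x div p              ≡⟨ div≡/ (suc x) p ⟩
      suc x / p                ≡⟨ cong (_/ p) (trans eq (trans (*-assoc p (p ^ e) c) (*-comm p _))) ⟩
      (p ^ e * c) * p / p      ≡⟨ m*n/n≡m (p ^ e * c) p ⟩
      p ^ e * c                ∎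
      where open ≡-Reasoning
    bound : suc x div p ≤ x
    bound = ≤-pred (subst (_< suc x) (sym (div≡/ (suc x) p)) (m/n<m (suc x) p (nonTrivial⇒n>1 p)))
  νfuel-unique (suc k) zero eq p∤c _ | no _ = refl
  νfuel-unique (suc k) (suc e) {suc x} {c} eq p∤c _ | no p∤x =
    contradiction (subst (p ∣_) (sym (trans eq (*-assoc p (p ^ e) c))) (m∣m*n _)) p∤x

  ν-unique : ∀ e {x c} → x ≡ p ^ e * c → p ∤ c → ν p x ≡ e
  ν-unique e {x} eq p∤c = νfuel-unique x e eq p∤c ≤-refl

  ν-spec : ∀ x .{{_ : NonZero x}} → ∃ λ c → x ≡ p ^ ν p x * c × p ∤ c
  ν-spec x with decompose x x ≤-refl
    where
    decompose : ∀ k x .{{_ : NonZero x}} → x ≤ k → ∃ λ e → ∃ λ c → x ≡ p ^ e * c × p ∤ c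
    decompose (suc k) (suc x) (s≤s x≤k) with p ∣? suc x
    ... | no p∤x = 0 , suc x , sym (*-identityˡ _) , p∤x
    ... | yes p∣x with decompose k (quotient p∣x) {{quotient≢0 p∣x}} (≤-trans (≤-pred (quotient-< p∣x)) x≤k)
    ...   | e , c , eq , p∤c = suc e , c , trans (m∣n⇒n≡m*quotient p∣x) (trans (cong (p *_) eq) (sym (*-assoc p (p ^ e) c))) , p∤c
  ... | e , c , eq , p∤c = c , trans eq (cong (λ e → p ^ e * c) (sym (ν-unique e eq p∤c))) , p∤c

  ν-* : ∀ x y .{{_ : NonZero x}} .{{_ : NonZero y}} → ν p (x * y) ≡ ν p x + ν p y
  ν-* x y with ν-spec x | ν-spec y
  ... | c , eqx , p∤c | d , eqy , p∤d = ν-unique (ν p x + ν p y) (begin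
      x * y                                   ≡⟨ cong₂ _*_ eqx eqy ⟩
      p ^ ν p x * c * (p ^ ν p y * d)         ≡⟨ [m*n]*[o*p]≡[m*o]*[n*p] (p ^ ν p x) c _ d ⟩
      p ^ ν p x * p ^ ν p y * (c * d)         ≡⟨ cong (_* (c * d)) (^-distribˡ-+-* p (ν p x) (ν p y)) ⟨
      p ^ (ν p x + ν p y) * (c * d)           ∎) (∤-* p∤c p∤d)
    where open ≡-Reasoning

  ν-∤ : ∀ {x} → p ∤ x → ν p x ≡ 0
  ν-∤ p∤x = ν-unique 0 (sym (*-identityˡ _)) p∤x

  ν-p* : ∀ x .{{_ : NonZero x}} → ν p (p * x) ≡ suc (ν p x)
  ν-p* x with ν-spec x
  ... | c , eq , p∤c = ν-unique (suc (ν p x)) (trans (cong (p *_) eq) (sym (*-assoc p _ c))) p∤c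

  module _ (z : ℕ) .{{_ : NonZero z}} (e : ℕ) (g P : ℕ → ℕ)
    (g≢0 : ∀ i → NonZero (g (suc i)))
    (P0 : P 0 ≡ 1) (Psuc : ∀ m → P (suc m) ≡ P m * g (suc m))
    (ν-g-∤ : ∀ i → z ∤ i → p ∤ g i)
    (ν-g-* : ∀ k .{{_ : NonZero k}} → ν p (g (z * k)) ≡ e + ν p k)
    where

    product≢0 : ∀ m → NonZero (P m)
    product≢0 zero = subst NonZero (sym P0) _
    product≢0 (suc m) = subst NonZero (sym (Psuc m)) (m*n≢0 (P m) (g (suc m)) {{product≢0 m}} {{g≢0 m}})

    ν-product-suc : ∀ m → ν p (P (suc m)) ≡ ν p (P m) + ν p (g (suc m))
    ν-product-suc m = trans (cong (ν p) (Psuc m)) (ν-* (P m) (g (suc m)) {{product≢0 m}} {{g≢0 m}})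

    -- Each of the k multiples of z up to j + z k contributes e plus the valuation of its cofactor;
    -- the other factors are prime to p. With `g` the identity and z = p this yields the recursion
    -- for factorials, with `g` = `F` and z the rank of appearance the valuation of `fibFact`.
    ν-product-block : ∀ k j → j < z → ν p (P (j + z * k)) ≡ e * k + ν p (k !)
    ν-product-block zero zero _ = begin
      ν p (P (z * 0))  ≡⟨ cong (λ t → ν p (P t)) (*-zeroʳ z) ⟩
      ν p (P 0)        ≡⟨ cong (ν p) P0 ⟩
      ν p 1            ≡⟨ cong (_+ ν p 1) (*-zeroʳ e) ⟨
      e * 0 + ν p 1    ∎
      where open ≡-Reasoning
    ν-product-block (suc k) zero _ = begin
      ν p (P (z * suc k))                                ≡⟨ cong (λ t → ν p (P t)) index ⟩
      ν p (P (suc (y + z * k)))                          ≡⟨ ν-product-suc (y + z * k) ⟩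
      ν p (P (y + z * k)) + ν p (g (suc (y + z * k)))    ≡⟨ cong (λ t → ν p (P (y + z * k)) + ν p (g t)) index ⟨
      ν p (P (y + z * k)) + ν p (g (z * suc k))          ≡⟨ cong₂ _+_ (ν-product-block k y (≤-reflexive (suc-pred z))) (ν-g-* (suc k)) ⟩
      (e * k + ν p (k !)) + (e + ν p (suc k))            ≡⟨ regroup e k (ν p (k !)) (ν p (suc k)) ⟩
      e * suc k + (ν p (suc k) + ν p (k !))              ≡⟨ cong (λ t → e * suc k + t) (ν-* (suc k) (k !) {{_}} {{k !≢0}}) ⟨
      e * suc k + ν p (suc k !)                          ∎
      where
      open ≡-Reasoning
      y : ℕ
      y = z ∸ 1
      index : z * suc k ≡ suc (y + z * k)
      index = trans (*-suc z k) (cong (_+ z * k) (sym (suc-pred z)))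
      regroup : ∀ e k a b → (e * k + a) + (e + b) ≡ e * suc k + (b + a)
      regroup = solve-∀
    ν-product-block k (suc j) 1+j<z = begin
      ν p (P (suc (j + z * k)))                          ≡⟨ ν-product-suc (j + z * k) ⟩
      ν p (P (j + z * k)) + ν p (g (suc (j + z * k)))    ≡⟨ cong₂ _+_ (ν-product-block k j (<-trans (n<1+n j) 1+j<z)) (ν-∤ (ν-g-∤ _ z∤)) ⟩
      (e * k + ν p (k !)) + 0                            ≡⟨ +-identityʳ _ ⟩
      e * k + ν p (k !)                                  ∎
      where
      open ≡-Reasoning
      z∤ : z ∤ suc j + z * k
      z∤ z∣ = >⇒∤ 1+j<z (∣m+n∣m⇒∣n (subst (z ∣_) (+-comm (suc j) (z * k)) z∣) (m∣m*n k))

    ν-product : ∀ m → ν p (P m) ≡ e * (m / z) + ν p ((m / z) !)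
    ν-product m = trans
      (cong (λ t → ν p (P t)) (trans (m≡m%n+[m/n]*n m z) (cong (λ t → m % z + t) (*-comm (m / z) z))))
      (ν-product-block (m / z) (m % z) (m%n<n m z))

  ν-factorial : ∀ m → ν p (m !) ≡ m / p + ν p ((m / p) !)
  ν-factorial m = trans
    (ν-product p 1 (λ i → i) _! (λ i → _) refl (λ m → *-comm (suc m) (m !)) (λ _ z∤i → z∤i) (λ k → ν-p* k) m)
    (cong (_+ ν p ((m / p) !)) (*-identityˡ (m / p)))

  -- Passing from m = r + p q to q removes r from the digit sum and q from the valuation of the
  -- factorial, and r + (p - 1) q + q = m.
  legendre : ∀ m → (p ∸ 1) * ν p (m !) + sp p m ≡ m
  legendre m = go m m ≤-refl
    where
    open ≡-Reasoning
    c : ℕ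
    c = p ∸ 1
    regroup : ∀ c q x r s → c * (q + x) + (r + s) ≡ r + (c * q + (c * x + s))
    regroup = solve-∀
    regroup′ : ∀ c q → c * q + q ≡ q * suc c
    regroup′ = solve-∀
    quotient≤ : ∀ k m → m ≤ suc k → m / p ≤ k
    quotient≤ k zero _ = ≤-trans (≤-reflexive (0/n≡0 p)) z≤n
    quotient≤ k (suc m) m≤k = ≤-pred (≤-trans (m/n<m (suc m) p (nonTrivial⇒n>1 p)) m≤k)
    -- Any fuel k ≥ m is allowed, because a digit step leaves k - 1 as fuel for m / p, which may be
    -- much smaller.
    go : ∀ k m → m ≤ k → (p ∸ 1) * ν p (m !) + sfuel k p m ≡ m
    go zero zero z≤n = trans (+-identityʳ _)
      (trans (cong (c *_) (ν-∤ (>⇒∤ (nonTrivial⇒n>1 p)))) (*-zeroʳ c))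
    go (suc k) m m≤k = begin
      c * ν p (m !) + (m mod p + sfuel k p (m div p))
        ≡⟨ cong₂ (λ x y → c * ν p (m !) + (x + sfuel k p y)) (mod≡% m p) (div≡/ m p) ⟩
      c * ν p (m !) + (m % p + sfuel k p (m / p))
        ≡⟨ cong (λ x → c * x + (m % p + sfuel k p (m / p))) (ν-factorial m) ⟩
      c * (m / p + ν p ((m / p) !)) + (m % p + sfuel k p (m / p))
        ≡⟨ regroup c (m / p) (ν p ((m / p) !)) (m % p) _ ⟩
      m % p + (c * (m / p) + (c * ν p ((m / p) !) + sfuel k p (m / p)))
        ≡⟨ cong (λ x → m % p + (c * (m / p) + x)) (go k (m / p) (quotient≤ k m m≤k)) ⟩
      m % p + (c * (m / p) + m / p)
        ≡⟨ cong (λ t → m % p + t) (regroup′ c (m / p)) ⟩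
      m % p + m / p * suc c
        ≡⟨ cong (λ x → m % p + m / p * x) (suc-pred p) ⟩
      m % p + m / p * p
        ≡⟨ m≡m%n+[m/n]*n m p ⟨
      m ∎

-- Fibonacci identities and the second-order expansion of F at multiples.

F-+ : ∀ m n → F (suc (m + n)) ≡ F (suc m) * F (suc n) + F m * F n
F-+ zero n = sym (trans (+-identityʳ _) (*-identityˡ _))
F-+ (suc m) n = begin
  F (suc (suc m + n))                                    ≡⟨ cong (λ t → F (suc t)) (+-suc m n) ⟨
  F (suc (m + suc n))                                    ≡⟨ F-+ m (suc n) ⟩
  F (suc m) * (F (suc n) + F n) + F m * F (suc n)        ≡⟨ regroup (F (suc m)) (F m) (F (suc n)) (F n) ⟩
  (F (suc m) + F m) * F (suc n) + F (suc m) * F n        ∎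
  where
  open ≡-Reasoning
  regroup : ∀ a b c d → a * (c + d) + b * c ≡ (a + b) * c + a * d
  regroup = solve-∀

F-suc≢0 : ∀ n → NonZero (F (suc n))
F-suc≢0 zero = _
F-suc≢0 (suc n) = >-nonZero (≤-trans (n≢0⇒n>0 (≢-nonZero⁻¹ _ {{F-suc≢0 n}})) (m≤m+n _ _))

F≢0 : ∀ n .{{_ : NonZero n}} → NonZero (F n)
F≢0 (suc n) = F-suc≢0 n

F∣F-* : ∀ m k → F m ∣ F (m * k)
F∣F-* m zero = subst (λ t → F m ∣ F t) (sym (*-zeroʳ m)) (F m ∣0)
F∣F-* zero (suc k) = ∣-refl
F∣F-* (suc m) (suc k) = subst (F (suc m) ∣_) (sym eq)
  (∣m∣n⇒∣m+n (m∣m*n _) (∣n⇒∣m*n (F m) (F∣F-* (suc m) k)))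
  where
  eq : F (suc m * suc k) ≡ F (suc m) * F (suc (suc m * k)) + F m * F (suc m * k)
  eq = trans (cong F (*-suc (suc m) k)) (F-+ m (suc m * k))

-- The binomial coefficient C(k, 2), which multiplies the quadratic term of the expansion below.
triangular : ℕ → ℕ
triangular zero = 0
triangular (suc k) = triangular k + k

2*triangular : ∀ k → 2 * triangular k + k ≡ k * k
2*triangular zero = refl
2*triangular (suc k) = trans (regroup (triangular k) k) (trans (cong (λ t → t + (k + suc k)) (2*triangular k)) (regroup′ k))
  where
  regroup : ∀ t k → 2 * (t + k) + suc k ≡ (2 * t + k) + (k + suc k)
  regroup = solve-∀
  regroup′ : ∀ k → k * k + (k + suc k) ≡ suc k * suc k
  regroup′ = solve-∀

-- The expansion of Q^{(m+1)k} = (u Q + b)^k modulo u³, where Q = (1 1; 1 0), u = F (suc m) and b = F m;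
-- R stands for F_{(m+1)k−1}, and the factor b² keeps all exponents of b nonnegative.
F-*-expansion : ∀ m k → let u = F (suc m); b = F m; T = triangular k in
  ∃ λ R → ∃ λ X → ∃ λ Y →
    F (suc (suc m * k)) ≡ F (suc m * k) + R ×
    b * b * F (suc m * k) ≡ k * u * (b * b ^ k) + T * (u * u) * b ^ k + u * u * u * X ×
    b * b * R ≡ b * b * b ^ k + T * (u * u) * b ^ k + u * u * u * Y
F-*-expansion m zero = 1 , 0 , 0
  , subst (λ t → F (suc t) ≡ F t + 1) (sym (*-zeroʳ m)) refl
  , trans (cong (λ t → F m * F m * F t) (*-zeroʳ m)) (trans (*-zeroʳ (F m * F m)) (sym (*-zeroʳ (F (suc m) * F (suc m) * F (suc m)))))
  , base (F m) (F (suc m))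
  where
  base : ∀ b u → b * b * 1 ≡ b * b * 1 + 0 * (u * u) * 1 + u * u * u * 0
  base = solve-∀
F-*-expansion m (suc k) with F-*-expansion m k
... | R , X , Y , eqR , eqP , eqQ =
  P * u + R * b , 2 * T * B + X * (u + b) + u * Y , T * B + u * X + Y * b , step₁ , step₂ , step₃
  where
  open ≡-Reasoning
  u b T B P : ℕ
  u = F (suc m)
  b = F m
  T = triangular k
  B = b ^ k
  P = F (suc m * k)
  P′ : F (suc m * suc k) ≡ u * (P + R) + b * P
  P′ = trans (cong F (*-suc (suc m) k)) (trans (F-+ m (suc m * k)) (cong (λ t → u * t + b * P) eqR))
  step₁ : F (suc (suc m * suc k)) ≡ F (suc m * suc k) + (P * u + R * b)
  step₁ = begin
    F (suc (suc m * suc k))                  ≡⟨ cong (λ t → F (suc t)) (*-suc (suc m) k) ⟩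
    F (suc (suc m + suc m * k))              ≡⟨ F-+ (suc m) (suc m * k) ⟩
    (u + b) * F (suc (suc m * k)) + u * P    ≡⟨ cong (λ t → (u + b) * t + u * P) eqR ⟩
    (u + b) * (P + R) + u * P                ≡⟨ regroup u b P R ⟩
    u * (P + R) + b * P + (P * u + R * b)    ≡⟨ cong (_+ (P * u + R * b)) P′ ⟨
    F (suc m * suc k) + (P * u + R * b)      ∎
    where
    regroup : ∀ u b P R → (u + b) * (P + R) + u * P ≡ u * (P + R) + b * P + (P * u + R * b)
    regroup = solve-∀
  step₂ : b * b * F (suc m * suc k) ≡ suc k * u * (b * (b * B)) + (T + k) * (u * u) * (b * B) + u * u * u * (2 * T * B + X * (u + b) + u * Y)
  step₂ = begin
    b * b * F (suc m * suc k)                          ≡⟨ cong (b * b *_) P′ ⟩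
    b * b * (u * (P + R) + b * P)                      ≡⟨ regroup b u P R ⟩
    b * b * P * (u + b) + b * b * R * u                ≡⟨ cong₂ (λ x y → x * (u + b) + y * u) eqP eqQ ⟩
    (k * u * (b * B) + T * (u * u) * B + u * u * u * X) * (u + b) + (b * b * B + T * (u * u) * B + u * u * u * Y) * u
                                                       ≡⟨ regroup′ b u T B k X Y ⟩
    suc k * u * (b * (b * B)) + (T + k) * (u * u) * (b * B) + u * u * u * (2 * T * B + X * (u + b) + u * Y) ∎
    where
    regroup : ∀ b u P R → b * b * (u * (P + R) + b * P) ≡ b * b * P * (u + b) + b * b * R * u
    regroup = solve-∀
    regroup′ : ∀ b u T B k X Y → (k * u * (b * B) + T * (u * u) * B + u * u * u * X) * (u + b) + (b * b * B + T * (u * u) * B + u * u * u * Y) * u ≡ suc k * u * (b * (b * B)) + (T + k) * (u * u) * (b * B) + u * u * u * (2 * T * B + X * (u + b) + u * Y)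
    regroup′ = solve-∀
  step₃ : b * b * (P * u + R * b) ≡ b * b * (b * B) + (T + k) * (u * u) * (b * B) + u * u * u * (T * B + u * X + Y * b)
  step₃ = begin
    b * b * (P * u + R * b)                ≡⟨ regroup b u P R ⟩
    b * b * P * u + b * b * R * b          ≡⟨ cong₂ (λ x y → x * u + y * b) eqP eqQ ⟩
    (k * u * (b * B) + T * (u * u) * B + u * u * u * X) * u + (b * b * B + T * (u * u) * B + u * u * u * Y) * b
                                           ≡⟨ regroup′ b u T B k X Y ⟩
    b * b * (b * B) + (T + k) * (u * u) * (b * B) + u * u * u * (T * B + u * X + Y * b) ∎
    where
    regroup : ∀ b u P R → b * b * (P * u + R * b) ≡ b * b * P * u + b * b * R * b
    regroup = solve-∀
    regroup′ : ∀ b u T B k X Y → (k * u * (b * B) + T * (u * u) * B + u * u * u * X) * u + (b * b * B + T * (u * u) * B + u * u * u * Y) * b ≡ b * b * (b * B) + (T + k) * (u * u) * (b * B) + u * u * u * (T * B + u * X + Y * b)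
    regroup′ = solve-∀

-- Integrality of the Fibonomial coefficients.

fibFact≢0 : ∀ m → NonZero (fibFact m)
fibFact≢0 zero = _
fibFact≢0 (suc m) = m*n≢0 (fibFact m) (F (suc m)) {{fibFact≢0 m}} {{F-suc≢0 m}}

-- Pascal's rule for Fibonomials: F_{k+l+2} = F_{k+1} F_{l+2} + F_k F_{l+1} splits the last factor,
-- and each summand falls under one induction hypothesis. Exact divisibility is needed because
-- `fibonomial` is defined by floor division.
fibFact-∣ : ∀ k l → fibFact k * fibFact l ∣ fibFact (k + l)
fibFact-∣ zero l = ∣-reflexive (*-identityˡ _)
fibFact-∣ (suc k) zero = ∣-reflexive (trans (*-identityʳ _) (cong (λ t → fibFact (suc t)) (sym (+-identityʳ k))))
fibFact-∣ (suc k) (suc l) = subst (fibFact (suc k) * fibFact (suc l) ∣_) (sym split)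
  (∣m∣n⇒∣m+n
    (subst (_∣ fibFact (k + suc l) * F (suc k) * F (suc (suc l))) (swap (fibFact k) (fibFact (suc l)) (F (suc k)))
      (∣m⇒∣m*n (F (suc (suc l))) (*-monoˡ-∣ (F (suc k)) (fibFact-∣ k (suc l)))))
    (subst (_∣ fibFact (suc k + l) * F (suc l) * F k) (*-assoc (fibFact (suc k)) (fibFact l) (F (suc l)))
      (∣m⇒∣m*n (F k) (*-monoˡ-∣ (F (suc l)) (fibFact-∣ (suc k) l)))))
  where
  swap : ∀ a b c → a * b * c ≡ a * c * b
  swap = solve-∀
  regroup : ∀ a b c d e → a * (b * c + d * e) ≡ a * b * c + a * e * d
  regroup = solve-∀
  split : fibFact (suc k + suc l) ≡ fibFact (k + suc l) * F (suc k) * F (suc (suc l)) + fibFact (suc k + l) * F (suc l) * F k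
  split = trans (cong (fibFact (k + suc l) *_) (F-+ k (suc l)))
    (trans (regroup (fibFact (k + suc l)) (F (suc k)) (F (suc (suc l))) (F k) (F (suc l)))
      (cong (λ t → fibFact (k + suc l) * F (suc k) * F (suc (suc l)) + fibFact t * F (suc l) * F k) (+-suc k l)))

-- Valuations of Fibonacci numbers and the rank of appearance.

module _ {p : ℕ} (pp : Prime p) where

  private instance
    p≢0 : NonZero p
    p≢0 = prime⇒nonZero pp
    p>1 : NonTrivial p
    p>1 = prime⇒nonTrivial pp

  ∤-^ : ∀ {x} k → p ∤ x → p ∤ x ^ k
  ∤-^ zero p∤x = >⇒∤ (nonTrivial⇒n>1 p)
  ∤-^ (suc k) p∤x = ∤-* pp p∤x (∤-^ k p∤x)

  F-consecutive : ∀ n → p ∣ F n → p ∤ F (suc n)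
  F-consecutive zero _ = >⇒∤ (nonTrivial⇒n>1 p)
  F-consecutive (suc n) p∣F₁ p∣F₂ = F-consecutive n (∣m+n∣m⇒∣n p∣F₂ p∣F₁) p∣F₁

  p∣triangular : p ≢ 2 → p ∣ triangular p
  p∣triangular p≢2 with euclidsLemma 2 (triangular p) pp
    (∣m+n∣m⇒∣n (subst (p ∣_) (trans (sym (2*triangular p)) (+-comm _ p)) (m∣m*n p)) ∣-refl)
  ... | inj₂ p∣T = p∣T
  ... | inj₁ p∣2 = contradiction (≤-antisym (∣⇒≤ p∣2) (nonTrivial⇒n>1 p)) p≢2

  module _ (m : ℕ) (p∣u : p ∣ F (suc m)) where

    private
      u b : ℕ
      u = F (suc m)
      b = F m
      instance
        u≢0 : NonZero u
        u≢0 = F-suc≢0 m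
      p∤b : p ∤ b
      p∤b p∣b = F-consecutive m p∣b p∣u

      -- Consecutive Fibonacci numbers are coprime to p in turn, so the factor b² that the expansion
      -- carries does not affect valuations.
      cancel-b² : ∀ x y .{{_ : NonZero x}} .{{_ : NonZero y}} → b * b * x ≡ y → ν p x ≡ ν p y
      cancel-b² x y eq = begin
        ν p x                    ≡⟨ cong (_+ ν p x) (ν-∤ pp p∤b²) ⟨
        ν p (b * b) + ν p x      ≡⟨ ν-* pp (b * b) x {{∤⇒nonZero p∤b²}} ⟨
        ν p (b * b * x)          ≡⟨ cong (ν p) eq ⟩
        ν p y                    ∎
        where
        open ≡-Reasoning
        p∤b² : p ∤ b * b
        p∤b² = ∤-* pp p∤b p∤b

    -- Once u is taken out of the expansion, every term but the linear one still contains u, and the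
    -- linear coefficient k b^{k+1} is prime to p.
    ν-F-*-coprime : ∀ k → p ∤ k → ν p (F (suc m * k)) ≡ ν p u
    ν-F-*-coprime k p∤k with F-*-expansion m k
    ... | R , X , Y , _ , eq , _ = begin
      ν p (F (suc m * k))    ≡⟨ cancel-b² _ (u * w) {{F≢0 (suc m * k) {{m*n≢0 (suc m) k {{_}} {{∤⇒nonZero p∤k}}}}}} {{m*n≢0 u w {{u≢0}} {{∤⇒nonZero p∤w}}}} (trans eq (regroup u b (b ^ k) k (triangular k) X)) ⟩
      ν p (u * w)            ≡⟨ ν-* pp u w {{u≢0}} {{∤⇒nonZero p∤w}} ⟩
      ν p u + ν p w          ≡⟨ cong (λ t → ν p u + t) (ν-∤ pp p∤w) ⟩
      ν p u + 0              ≡⟨ +-identityʳ _ ⟩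
      ν p u                  ∎
      where
      open ≡-Reasoning
      w′ w : ℕ
      w′ = triangular k * b ^ k + u * X
      w = u * w′ + k * (b * b ^ k)
      p∤w : p ∤ w
      p∤w p∣w = ∤-* pp p∤k (∤-^ (suc k) p∤b) (∣m+n∣m⇒∣n p∣w (∣m⇒∣m*n w′ p∣u))
      regroup : ∀ u b B k T X → k * u * (b * B) + T * (u * u) * B + u * u * u * X ≡ u * (u * (T * B + u * X) + k * (b * B))
      regroup = solve-∀

    -- The expansion is u (p b^{p+1} + T u b^p + u² X). As p divides both T and u, the bracket is p
    -- times something congruent to b^{p+1} modulo u, hence exactly one further factor p.
    ν-F-*p : p ≢ 2 → ν p (F (suc m * p)) ≡ suc (ν p u)
    ν-F-*p p≢2 with F-*-expansion m p | p∣triangular p≢2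
    ... | R , X , Y , _ , eq , _ | divides T′ T≡ = begin
      ν p (F (suc m * p))    ≡⟨ cancel-b² _ (u * (p * w)) {{F≢0 (suc m * p) {{m*n≢0 (suc m) p}}}} {{m*n≢0 u (p * w) {{u≢0}} {{pw≢0}}}} (trans eq expand) ⟩
      ν p (u * (p * w))      ≡⟨ ν-* pp u (p * w) {{u≢0}} {{pw≢0}} ⟩
      ν p u + ν p (p * w)    ≡⟨ cong (λ t → ν p u + t) (ν-p* pp w {{∤⇒nonZero p∤w}}) ⟩
      ν p u + suc (ν p w)    ≡⟨ cong (λ t → ν p u + suc t) (ν-∤ pp p∤w) ⟩
      ν p u + 1              ≡⟨ +-comm _ 1 ⟩
      suc (ν p u)            ∎
      where
      open ≡-Reasoning
      u′ w′ w B : ℕ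
      u′ = quotient p∣u
      B = b ^ p
      w′ = T′ * B + u′ * X
      w = u * w′ + b * B
      p∤w : p ∤ w
      p∤w p∣w = ∤-^ (suc p) p∤b (∣m+n∣m⇒∣n p∣w (∣m⇒∣m*n w′ p∣u))
      pw≢0 : NonZero (p * w)
      pw≢0 = m*n≢0 p w {{p≢0}} {{∤⇒nonZero p∤w}}
      regroup : ∀ p u u′ b B T′ X → p * u * (b * B) + T′ * p * (u * u) * B + u * u * (u′ * p) * X ≡ u * (p * (u * (T′ * B + u′ * X) + b * B))
      regroup = solve-∀
      expand : p * u * (b * B) + triangular p * (u * u) * B + u * u * u * X ≡ u * (p * w)
      expand = trans
        (cong₂ (λ s t → p * u * (b * B) + s * (u * u) * B + u * u * t * X) T≡ (m∣n⇒n≡quotient*m p∣u))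
        (regroup p u u′ b B T′ X)

  -- The factors p of k are removed one at a time by `ν-F-*p`, with m q in place of m; this is
  -- allowed because F_m divides F_{mq}. The rest is the coprime case.
  ν-F-* : p ≢ 2 → ∀ m .{{_ : NonZero m}} → p ∣ F m → ∀ k .{{_ : NonZero k}} → ν p (F (m * k)) ≡ ν p (F m) + ν p k
  ν-F-* p≢2 m p∣F k = go k k ≤-refl
    where
    open ≡-Reasoning
    go : ∀ l k .{{_ : NonZero k}} → k ≤ l → ν p (F (m * k)) ≡ ν p (F m) + ν p k
    go zero (suc k) ()
    go (suc l) k k≤l with p ∣? k
    ... | no p∤k = begin
      ν p (F (m * k))           ≡⟨ cong (λ t → ν p (F (t * k))) (suc-pred m) ⟨
      ν p (F (suc (m ∸ 1) * k)) ≡⟨ ν-F-*-coprime (m ∸ 1) (subst (λ t → p ∣ F t) (sym (suc-pred m)) p∣F) k p∤k ⟩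
      ν p (F (suc (m ∸ 1)))     ≡⟨ cong (λ t → ν p (F t)) (suc-pred m) ⟩
      ν p (F m)                 ≡⟨ +-identityʳ _ ⟨
      ν p (F m) + 0             ≡⟨ cong (λ t → ν p (F m) + t) (ν-∤ pp p∤k) ⟨
      ν p (F m) + ν p k         ∎
    ... | yes p∣k = begin
      ν p (F (m * k))             ≡⟨ cong (λ t → ν p (F t)) (trans (cong (m *_) (m∣n⇒n≡quotient*m p∣k)) (sym (*-assoc m q p))) ⟩
      ν p (F (m * q * p))         ≡⟨ cong (λ t → ν p (F (t * p))) (suc-pred (m * q) {{mq≢0}}) ⟨
      ν p (F (suc (m * q ∸ 1) * p)) ≡⟨ ν-F-*p (m * q ∸ 1) (subst (λ t → p ∣ F t) (sym (suc-pred (m * q) {{mq≢0}})) (∣-trans p∣F (F∣F-* m q))) p≢2 ⟩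
      suc (ν p (F (suc (m * q ∸ 1)))) ≡⟨ cong (λ t → suc (ν p (F t))) (suc-pred (m * q) {{mq≢0}}) ⟩
      suc (ν p (F (m * q)))       ≡⟨ cong suc (go l q {{q≢0}} (≤-pred (≤-trans (quotient-< p∣k) k≤l))) ⟩
      suc (ν p (F m) + ν p q)     ≡⟨ +-suc _ _ ⟨
      ν p (F m) + suc (ν p q)     ≡⟨ cong (λ t → ν p (F m) + t) (ν-p* pp q {{q≢0}}) ⟨
      ν p (F m) + ν p (p * q)     ≡⟨ cong (λ t → ν p (F m) + ν p t) (m∣n⇒n≡m*quotient p∣k) ⟨
      ν p (F m) + ν p k           ∎
      where
      q : ℕ
      q = quotient p∣k
      instance
        q≢0 : NonZero q
        q≢0 = quotient≢0 p∣k
      mq≢0 : NonZero (m * q)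
      mq≢0 = m*n≢0 m q

  module _ {z : ℕ} .{{_ : NonZero z}} (rank : IsRankOfAppearance p z) where

    private
      p∣Fz : p ∣ F z
      p∣Fz = proj₁ (proj₂ rank)

    -- For i = r + z q with r > 0, the addition formula and p ∣ F_{zq} give p ∣ F_r F_{zq+1}. The
    -- second factor is prime to p, and p ∣ F_r contradicts the minimality of z.
    rank-∣ : ∀ i → p ∣ F i → z ∣ i
    rank-∣ i p∣Fi = m%n≡0⇒n∣m i z (remainder (i % z) (m%n<n i z)
      (subst (λ t → p ∣ F t) (trans (m≡m%n+[m/n]*n i z) (cong (λ t → i % z + t) (*-comm (i / z) z))) p∣Fi))
      where
      remainder : ∀ r → r < z → p ∣ F (r + z * (i / z)) → r ≡ 0
      remainder zero _ _ = refl
      remainder (suc r) r<z p∣F = contradiction p∣FrF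
        (∤-* pp (proj₂ (proj₂ rank) (suc r) (s≤s z≤n) r<z) (F-consecutive (z * (i / z)) p∣Fq))
        where
        p∣Fq : p ∣ F (z * (i / z))
        p∣Fq = ∣-trans p∣Fz (F∣F-* z (i / z))
        p∣FrF : p ∣ F (suc r) * F (suc (z * (i / z)))
        p∣FrF = ∣m+n∣m⇒∣n (subst (p ∣_) (trans (F-+ r (z * (i / z))) (+-comm (F (suc r) * _) _)) p∣F) (∣n⇒∣m*n (F r) p∣Fq)

    ν-fibFact : p ≢ 2 → ∀ m → ν p (fibFact m) ≡ ν p (F z) * (m / z) + ν p ((m / z) !)
    ν-fibFact p≢2 = ν-product pp z (ν p (F z)) F fibFact F-suc≢0 refl (λ _ → refl)
      (λ i z∤i p∣Fi → z∤i (rank-∣ i p∣Fi)) (λ k → ν-F-* p≢2 z p∣Fz k)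

  ν-fibonomial : ∀ k l → ν p (fibonomial (k + l) k) + (ν p (fibFact k) + ν p (fibFact l)) ≡ ν p (fibFact (k + l))
  ν-fibonomial k l = begin
    ν p (fibonomial (k + l) k) + (ν p (fibFact k) + ν p (fibFact l))
      ≡⟨ cong₂ (λ s t → ν p s + t) quot (sym (ν-* pp (fibFact k) (fibFact l) {{fibFact≢0 k}} {{fibFact≢0 l}})) ⟩
    ν p q + ν p d          ≡⟨ ν-* pp q d {{q≢0}} {{d≢0}} ⟨
    ν p (q * d)            ≡⟨ cong (ν p) (m∣n⇒n≡quotient*m d∣) ⟨
    ν p (fibFact (k + l))  ∎
    where
    open ≡-Reasoning
    d q : ℕ
    d = fibFact k * fibFact l
    d∣ : d ∣ fibFact (k + l)
    d∣ = fibFact-∣ k l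
    q = quotient d∣
    d≢0 : NonZero d
    d≢0 = m*n≢0 (fibFact k) (fibFact l) {{fibFact≢0 k}} {{fibFact≢0 l}}
    q≢0 : NonZero q
    q≢0 = quotient≢0 d∣ {{fibFact≢0 (k + l)}}
    quot : fibonomial (k + l) k ≡ q
    quot = begin
      fibFact (k + l) div (fibFact k * fibFact (k + l ∸ k))  ≡⟨ cong (λ t → fibFact (k + l) div (fibFact k * fibFact t)) (m+n∸m≡n k l) ⟩
      fibFact (k + l) div d                                  ≡⟨ div≡/ _ d {{d≢0}} ⟩
      (fibFact (k + l) / d) {{d≢0}}                          ≡⟨ n/m≡quotient d∣ {{d≢0}} ⟩
      q                                                      ∎

-- Binomial sums over ℤ and their reduction modulo p.

∑≤ : ℕ → (ℕ → ℤ) → ℤ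
∑≤ zero f = f 0
∑≤ (suc n) f = ∑≤ n f ℤ.+ f (suc n)

∑≤-cong : ∀ n {f g} → (∀ k → f k ≡ g k) → ∑≤ n f ≡ ∑≤ n g
∑≤-cong zero eq = eq 0
∑≤-cong (suc n) eq = cong₂ ℤ._+_ (∑≤-cong n eq) (eq (suc n))

∑≤-+ : ∀ n f g → ∑≤ n (λ k → f k ℤ.+ g k) ≡ ∑≤ n f ℤ.+ ∑≤ n g
∑≤-+ zero f g = refl
∑≤-+ (suc n) f g = trans (cong (ℤ._+ (f (suc n) ℤ.+ g (suc n))) (∑≤-+ n f g)) (regroup (∑≤ n f) (∑≤ n g) (f (suc n)) (g (suc n)))
  where
  regroup : ∀ a b c d → (a ℤ.+ b) ℤ.+ (c ℤ.+ d) ≡ (a ℤ.+ c) ℤ.+ (b ℤ.+ d)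
  regroup = ℤ-Solver.solve-∀

∑≤-head : ∀ n f → ∑≤ (suc n) f ≡ f 0 ℤ.+ ∑≤ n (λ k → f (suc k))
∑≤-head zero f = refl
∑≤-head (suc n) f = trans (cong (ℤ._+ f (suc (suc n))) (∑≤-head n f)) (ℤₚ.+-assoc (f 0) _ _)

∑≤-∣ : ∀ {d} n f → (∀ k → k ≤ n → d ℤᵈ.∣ f k) → d ℤᵈ.∣ ∑≤ n f
∑≤-∣ zero f d∣f = d∣f 0 z≤n
∑≤-∣ (suc n) f d∣f = ℤᵈ.∣m∣n⇒∣m+n (∑≤-∣ n f (λ k k≤n → d∣f k (m≤n⇒m≤1+n k≤n))) (d∣f (suc n) ≤-refl)

binomialSum : ℕ → (ℕ → ℤ) → ℤ
binomialSum n f = ∑≤ n (λ k → + (n C k) ℤ.* f k)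

binomialSum-cong : ∀ n {f g} → (∀ k → f k ≡ g k) → binomialSum n f ≡ binomialSum n g
binomialSum-cong n eq = ∑≤-cong n (λ k → cong (+ (n C k) ℤ.*_) (eq k))

binomialSum-+ : ∀ n f g → binomialSum n (λ k → f k ℤ.+ g k) ≡ binomialSum n f ℤ.+ binomialSum n g
binomialSum-+ n f g = trans (∑≤-cong n (λ k → ℤₚ.*-distribˡ-+ (+ (n C k)) (f k) (g k))) (∑≤-+ n _ _)

-- Pascal's rule; the vanishing coefficient C(n, n + 1) closes up the shifted sum.
binomialSum-suc : ∀ n f → binomialSum (suc n) f ≡ binomialSum n (λ k → f k ℤ.+ f (suc k))
binomialSum-suc n f = begin
  binomialSum (suc n) f
    ≡⟨ ∑≤-head n _ ⟩
  + 1 ℤ.* f 0 ℤ.+ ∑≤ n (λ k → + (suc n C suc k) ℤ.* f (suc k))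
    ≡⟨ cong (λ t → + 1 ℤ.* f 0 ℤ.+ t) (trans (∑≤-cong n pascal) (∑≤-+ n _ _)) ⟩
  + 1 ℤ.* f 0 ℤ.+ (binomialSum n (λ k → f (suc k)) ℤ.+ ∑≤ n (λ k → + (n C suc k) ℤ.* f (suc k)))
    ≡⟨ swap (+ 1 ℤ.* f 0) _ _ ⟩
  (+ 1 ℤ.* f 0 ℤ.+ ∑≤ n (λ k → + (n C suc k) ℤ.* f (suc k))) ℤ.+ binomialSum n (λ k → f (suc k))
    ≡⟨ cong (ℤ._+ binomialSum n (λ k → f (suc k))) (∑≤-head n (λ k → + (n C k) ℤ.* f k)) ⟨
  (binomialSum n f ℤ.+ + (n C suc n) ℤ.* f (suc n)) ℤ.+ binomialSum n (λ k → f (suc k))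
    ≡⟨ cong (λ t → (binomialSum n f ℤ.+ + t ℤ.* f (suc n)) ℤ.+ binomialSum n (λ k → f (suc k))) (k>n⇒nCk≡0 (n<1+n n)) ⟩
  (binomialSum n f ℤ.+ 0ℤ ℤ.* f (suc n)) ℤ.+ binomialSum n (λ k → f (suc k))
    ≡⟨ cong (ℤ._+ binomialSum n (λ k → f (suc k))) (trans (cong (λ t → binomialSum n f ℤ.+ t) (ℤₚ.*-zeroˡ (f (suc n)))) (ℤₚ.+-identityʳ (binomialSum n f))) ⟩
  binomialSum n f ℤ.+ binomialSum n (λ k → f (suc k))
    ≡⟨ binomialSum-+ n f _ ⟨
  binomialSum n (λ k → f k ℤ.+ f (suc k)) ∎
  where
  open ≡-Reasoning
  pascal : ∀ k → + (suc n C suc k) ℤ.* f (suc k) ≡ + (n C k) ℤ.* f (suc k) ℤ.+ + (n C suc k) ℤ.* f (suc k)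
  pascal k = trans (cong (λ t → + t ℤ.* f (suc k)) (sym (nCk+nC[k+1]≡[n+1]C[k+1] n k)))
    (trans (cong (ℤ._* f (suc k)) (ℤₚ.pos-+ (n C k) (n C suc k))) (ℤₚ.*-distribʳ-+ (f (suc k)) (+ (n C k)) (+ (n C suc k))))
  swap : ∀ a b c → a ℤ.+ (b ℤ.+ c) ≡ (a ℤ.+ c) ℤ.+ b
  swap = ℤ-Solver.solve-∀

module _ {p : ℕ} (pp : Prime p) where

  private instance
    p≢0 : NonZero p
    p≢0 = prime⇒nonZero pp
    p>1 : NonTrivial p
    p>1 = prime⇒nonTrivial pp

  p∤k! : ∀ k → k < p → p ∤ k !
  p∤k! zero _ = >⇒∤ (nonTrivial⇒n>1 p)
  p∤k! (suc k) k<p = ∤-* pp (>⇒∤ k<p) (p∤k! k (<-trans (n<1+n k) k<p))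

  p∣p! : p ∣ p !
  p∣p! = subst (λ t → t ∣ t !) (suc-pred p) (m∣m*n ((p ∸ 1) !))

  p∣pCk : ∀ k → 0 < k → k < p → p ∣ p C k
  p∣pCk k 0<k k<p with euclidsLemma (p C k) (k ! * (p ∸ k) !) pp (subst (p ∣_) (sym eq) p∣p!)
    where
    instance
      d≢0 : NonZero (k ! * (p ∸ k) !)
      d≢0 = k !* (p ∸ k) !≢0
    eq : (p C k) * (k ! * (p ∸ k) !) ≡ p !
    eq = trans (cong (_* (k ! * (p ∸ k) !)) (nCk≡n!/k![n-k]! (<⇒≤ k<p))) (m/n*n≡m (k![n∸k]!∣n! (<⇒≤ k<p)))
  ... | inj₁ p∣C = p∣C
  ... | inj₂ p∣d = contradiction p∣d (∤-* pp (p∤k! k k<p) (p∤k! (p ∸ k) (∸-monoʳ-< 0<k (<⇒≤ k<p))))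

  -- The interior coefficients C(p, k) vanish modulo p. This is the congruence (x + y)^p ≡ x^p +
  -- y^p, seen through a functional that kills both end terms.
  p∣binomialSum : ∀ f → f 0 ≡ 0ℤ → f p ≡ 0ℤ → + p ℤᵈ.∣ binomialSum p f
  p∣binomialSum f f0 fp = ∑≤-∣ p _ term
    where
    term : ∀ k → k ≤ p → + p ℤᵈ.∣ + (p C k) ℤ.* f k
    term zero _ = ℤᵈ.∣n⇒∣m*n (+ (p C 0)) (subst (+ p ℤᵈ.∣_) (sym f0) (ℤᵈ.∣ᵤ⇒∣ (p ∣0)))
    term (suc k) k≤p with m≤n⇒m<n∨m≡n k≤p
    ... | inj₁ k<p = ℤᵈ.∣m⇒∣m*n {m = + (p C suc k)} (f (suc k)) (ℤᵈ.∣ᵤ⇒∣ (p∣pCk (suc k) (s≤s z≤n) k<p))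
    ... | inj₂ refl = ℤᵈ.∣n⇒∣m*n (+ (p C p)) (subst (+ p ℤᵈ.∣_) (sym fp) (ℤᵈ.∣ᵤ⇒∣ (p ∣0)))

-- Fifth roots of unity and divisibility of Fibonacci numbers next to p.

-- Coordinates of ζ^m + ζ^{−m} in the basis 1, τ = ζ + ζ^{−1}, for ζ a primitive fifth root of unity.
traceConst traceτ : ℕ → ℤ
traceConst 0 = + 2
traceConst 1 = + 0
traceConst 2 = -[1+ 0 ]
traceConst 3 = -[1+ 0 ]
traceConst 4 = + 0
traceConst (suc (suc (suc (suc (suc m))))) = traceConst m
traceτ 0 = + 0
traceτ 1 = + 1
traceτ 2 = -[1+ 0 ]
traceτ 3 = -[1+ 0 ]
traceτ 4 = + 1
traceτ (suc (suc (suc (suc (suc m))))) = traceτ m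

multτ : (ℕ → ℤ) → ℕ → ℤ
multτ g m = g (1 + m) ℤ.+ g (4 + m)

-- From τ² = 1 - τ one gets τ(a + bτ) = b + (a - b)τ. This lemma reads off the constant coordinate,
-- `multτ-traceτ` the other one.
multτ-traceConst : ∀ m → multτ traceConst m ≡ traceτ m
multτ-traceConst 0 = refl
multτ-traceConst 1 = refl
multτ-traceConst 2 = refl
multτ-traceConst 3 = refl
multτ-traceConst 4 = refl
multτ-traceConst (suc (suc (suc (suc (suc m))))) = multτ-traceConst m

multτ-traceτ : ∀ m → multτ traceτ m ℤ.+ traceτ m ≡ traceConst m
multτ-traceτ 0 = refl
multτ-traceτ 1 = refl
multτ-traceτ 2 = refl
multτ-traceτ 3 = refl
multτ-traceτ 4 = refl
multτ-traceτ (suc (suc (suc (suc (suc m))))) = multτ-traceτ m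

periodic : ∀ (g : ℕ → ℤ) → (∀ m → g (5 + m) ≡ g m) → ∀ m → g m ≡ g (m % 5)
periodic g per m = trans (cong g (trans (m≡m%n+[m/n]*n m 5) (+-comm (m % 5) _))) (shift (m / 5))
  where
  shift : ∀ q → g (q * 5 + m % 5) ≡ g (m % 5)
  shift zero = refl
  shift (suc q) = trans (per (q * 5 + m % 5)) (shift q)

-- If g is 5-periodic, this is the image of (x + x^{−1})^n under x^m ↦ g m, the exponent −2k being replaced by 3k.
walkSum : ℕ → (ℕ → ℤ) → ℤ
walkSum n g = binomialSum n (λ k → g (n + 3 * k))

walkSum-suc : ∀ n g → walkSum (suc n) g ≡ walkSum n (multτ g)
walkSum-suc n g = trans (binomialSum-suc n _) (binomialSum-cong n λ k →
  cong (λ t → g (suc (n + 3 * k)) ℤ.+ g t) (regroup n k))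
  where
  regroup : ∀ n k → suc n + 3 * suc k ≡ 4 + (n + 3 * k)
  regroup = solve-∀

walkSum-traceConst : ∀ n → walkSum (suc n) traceConst ≡ walkSum n traceτ
walkSum-traceConst n = trans (walkSum-suc n traceConst) (binomialSum-cong n (λ k → multτ-traceConst (n + 3 * k)))

walkSum-traceτ : ∀ n → walkSum (suc n) traceτ ℤ.+ walkSum n traceτ ≡ walkSum n traceConst
walkSum-traceτ n = trans (cong (ℤ._+ walkSum n traceτ) (walkSum-suc n traceτ))
  (trans (sym (binomialSum-+ n _ _)) (binomialSum-cong n (λ k → multτ-traceτ (n + 3 * k))))

sign-alternating : ℕ → ℤ
sign-alternating zero = -[1+ 0 ]
sign-alternating (suc n) = ℤ.- sign-alternating n

∣sign-alternating∣ : ∀ n → ℤ.∣ sign-alternating n ∣ ≡ 1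
∣sign-alternating∣ zero = refl
∣sign-alternating∣ (suc n) = trans (ℤₚ.∣-i∣≡∣i∣ (sign-alternating n)) (∣sign-alternating∣ n)

walkSum≡F : ∀ n → walkSum n traceτ ≡ sign-alternating n ℤ.* + (2 * F n)
walkSum≡F zero = refl
walkSum≡F (suc zero) = refl
walkSum≡F (suc (suc n)) = begin
  w₂                                  ≡⟨ add-sub w₂ w₁ ⟩
  (w₂ ℤ.+ w₁) ℤ.- w₁                  ≡⟨ cong (ℤ._- w₁) (trans (walkSum-traceτ (suc n)) (walkSum-traceConst n)) ⟩
  walkSum n traceτ ℤ.- w₁             ≡⟨ cong₂ ℤ._-_ (walkSum≡F n) (walkSum≡F (suc n)) ⟩
  s ℤ.* + (2 * F n) ℤ.- ℤ.- s ℤ.* + (2 * F (suc n))   ≡⟨ regroup s (+ (2 * F n)) (+ (2 * F (suc n))) ⟩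
  ℤ.- ℤ.- s ℤ.* (+ (2 * F (suc n)) ℤ.+ + (2 * F n))   ≡⟨ cong (ℤ.- ℤ.- s ℤ.*_) (trans (cong +_ (*-distribˡ-+ 2 (F (suc n)) (F n))) (ℤₚ.pos-+ (2 * F (suc n)) (2 * F n))) ⟨
  ℤ.- ℤ.- s ℤ.* + (2 * F (suc (suc n)))               ∎
  where
  open ≡-Reasoning
  w₁ w₂ s : ℤ
  w₁ = walkSum (suc n) traceτ
  w₂ = walkSum (suc (suc n)) traceτ
  s = sign-alternating n
  add-sub : ∀ a b → a ≡ (a ℤ.+ b) ℤ.- b
  add-sub = ℤ-Solver.solve-∀
  regroup : ∀ s a b → s ℤ.* a ℤ.- ℤ.- s ℤ.* b ≡ ℤ.- ℤ.- s ℤ.* (b ℤ.+ a)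
  regroup = ℤ-Solver.solve-∀

module _ {p : ℕ} (pp : Prime p) (p≢2 : p ≢ 2) where

  private instance
    p≢0 : NonZero p
    p≢0 = prime⇒nonZero pp
    p>1 : NonTrivial p
    p>1 = prime⇒nonTrivial pp

  p∣walkSum⇒p∣F : ∀ n → + p ℤᵈ.∣ walkSum n traceτ → p ∣ F n
  p∣walkSum⇒p∣F n p∣w with euclidsLemma 2 (F n) pp (subst (p ∣_) abs (ℤᵈ.∣⇒∣ᵤ p∣w))
    where
    abs : ℤ.∣ walkSum n traceτ ∣ ≡ 2 * F n
    abs = trans (cong ℤ.∣_∣ (walkSum≡F n)) (trans (ℤₚ.abs-* (sign-alternating n) (+ (2 * F n)))
      (trans (cong (_* (2 * F n)) (∣sign-alternating∣ n)) (*-identityˡ _)))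
  ... | inj₂ p∣F = p∣F
  ... | inj₁ p∣2 = contradiction (≤-antisym (∣⇒≤ p∣2) (nonTrivial⇒n>1 p)) p≢2

  p∣walkSum : ∀ (g : ℕ → ℤ) → (∀ m → g (5 + m) ≡ g m) → g (p % 5) ≡ 0ℤ → g (4 * (p % 5) % 5) ≡ 0ℤ → + p ℤᵈ.∣ walkSum p g
  p∣walkSum g per g₁ g₄ = p∣binomialSum pp (λ k → g (p + 3 * k))
    (trans (cong g (+-identityʳ p)) (trans (periodic g per p) g₁))
    (trans (periodic g per (4 * p)) (trans (cong g (%-distribˡ-* 4 p 5)) g₄))

  p∣F[p-1] : p % 5 ≡ 1 ⊎ p % 5 ≡ 4 → p ∣ F (p ∸ 1)
  p∣F[p-1] p%5 = p∣walkSum⇒p∣F (p ∸ 1) (subst (+ p ℤᵈ.∣_)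
    (trans (cong (λ t → walkSum t traceConst) (sym (suc-pred p))) (walkSum-traceConst (p ∸ 1)))
    (p∣walkSum traceConst (λ _ → refl) ([ cong traceConst , cong traceConst ]′ p%5)
      ([ cong (λ t → traceConst (4 * t % 5)) , cong (λ t → traceConst (4 * t % 5)) ]′ p%5)))

  p∣F[p+1] : p % 5 ≡ 2 ⊎ p % 5 ≡ 3 → p ∣ F (suc p)
  p∣F[p+1] p%5 = p∣walkSum⇒p∣F (suc p) (subst (+ p ℤᵈ.∣_) (sym (walkSum-suc p traceτ))
    (p∣walkSum (multτ traceτ) (λ _ → refl) ([ cong (multτ traceτ) , cong (multτ traceτ) ]′ p%5)
      ([ cong (λ t → multτ traceτ (4 * t % 5)) , cong (λ t → multτ traceτ (4 * t % 5)) ]′ p%5)))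

-- Iverson brackets, carries and residues modulo z.

[]-yes : ∀ {P : Set} (d : Dec P) → P → [ d ] ≡ 1
[]-yes (yes _) _ = refl
[]-yes (no ¬p) p = contradiction p ¬p

[]-no : ∀ {P : Set} (d : Dec P) → ¬ P → [ d ] ≡ 0
[]-no (yes p) ¬p = contradiction p ¬p
[]-no (no _) _ = refl

[]-cong : ∀ {P Q : Set} (d : Dec P) (e : Dec Q) → (P → Q) → (Q → P) → [ d ] ≡ [ e ]
[]-cong d (yes q) _ g = []-yes d (g q)
[]-cong d (no ¬q) f _ = []-no d (λ p → ¬q (f p))

module _ (z : ℕ) .{{_ : NonZero z}} where

  /%-unique : ∀ {x} q {r} → r < z → x ≡ r + q * z → x / z ≡ q × x % z ≡ r
  /%-unique q {r} r<z refl =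
    trans (+-distrib-/-∣ʳ r (n∣m*n q)) (cong₂ _+_ (m<n⇒m/n≡0 r<z) (m*n/n≡m q z)) ,
    trans ([m+kn]%n≡m%n r q z) (m<n⇒m%n≡m r<z)

  -- A carry lowers the residue of the sum below that of x, because the residue of y is less than z;
  -- without a carry the residue cannot drop. This is the source of the brackets comparing r and s.
  /%-carry : ∀ x y → (x + y) / z ≡ x / z + y / z + [ (x + y) % z <? x % z ]
                   × x % z + y % z ≡ (x + y) % z + z * [ (x + y) % z <? x % z ]
  /%-carry x y with x % z + y % z <? z
  ... | yes r<z with /%-unique (x / z + y / z) r<z split
    where
    regroup : ∀ a b c d z → (a + b * z) + (c + d * z) ≡ (a + c) + (b + d) * z
    regroup = solve-∀
    split : x + y ≡ (x % z + y % z) + (x / z + y / z) * z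
    split = trans (cong₂ _+_ (m≡m%n+[m/n]*n x z) (m≡m%n+[m/n]*n y z)) (regroup (x % z) (x / z) (y % z) (y / z) z)
  ...   | q≡ , r≡ = trans q≡ (sym (trans (cong (λ t → x / z + y / z + t) no-carry) (+-identityʳ _)))
                  , sym (trans (cong₂ (λ s t → s + z * t) r≡ no-carry) (trans (cong (λ t → x % z + y % z + t) (*-zeroʳ z)) (+-identityʳ _)))
    where
    no-carry : [ (x + y) % z <? x % z ] ≡ 0
    no-carry = []-no _ (≤⇒≯ (subst (x % z ≤_) (sym r≡) (m≤m+n (x % z) (y % z))))
  /%-carry x y | no r≮z with /%-unique (suc (x / z + y / z)) w<z split
    where
    w : ℕ
    w = x % z + y % z ∸ z
    w+z : w + z ≡ x % z + y % z
    w+z = m∸n+n≡m (≮⇒≥ r≮z)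
    w<z : w < z
    w<z = +-cancelʳ-< z w z (subst (_< z + z) (sym w+z) (+-mono-< (m%n<n x z) (m%n<n y z)))
    regroup : ∀ a b c d z → (a + b * z) + (c + d * z) ≡ (a + c) + (b + d) * z
    regroup = solve-∀
    split : x + y ≡ w + suc (x / z + y / z) * z
    split = trans (cong₂ _+_ (m≡m%n+[m/n]*n x z) (m≡m%n+[m/n]*n y z))
      (trans (regroup (x % z) (x / z) (y % z) (y / z) z)
      (trans (cong (_+ (x / z + y / z) * z) (sym w+z)) (+-assoc w z _)))
  ...   | q≡ , r≡ = trans q≡ (sym (trans (cong (λ t → x / z + y / z + t) carry) (+-comm _ 1)))
                  , sym (trans (cong₂ (λ s t → s + z * t) r≡ carry) (trans (cong (λ t → x % z + y % z ∸ z + t) (*-identityʳ z)) (m∸n+n≡m (≮⇒≥ r≮z))))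
    where
    carry : [ (x + y) % z <? x % z ] ≡ 1
    carry = []-yes _ (subst (_< x % z) (sym r≡) (+-cancelʳ-< z _ (x % z)
      (subst (_< x % z + z) (sym (m∸n+n≡m (≮⇒≥ r≮z))) (+-monoʳ-< (x % z) (m%n<n y z)))))

  -- The sum has residue 0, so a carry occurs exactly if x has a nonzero residue. It is applied to m
  -- and p m when p ≡ -1 modulo z.
  %-complement : ∀ x y → z ∣ x + y → x % z + y % z ≡ z * [ ¬? (x % z ≟ 0) ]
  %-complement x y z∣x+y = trans (proj₂ (/%-carry x y)) (cong₂ (λ s t → s + z * t) x+y≡0
    ([]-cong _ (¬? (x % z ≟ 0)) (λ x+y<x x≡0 → n≮0 (subst ((x + y) % z <_) x≡0 x+y<x)) (λ x≢0 → subst (_< x % z) (sym x+y≡0) (n≢0⇒n>0 x≢0))))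
    where
    x+y≡0 : (x + y) % z ≡ 0
    x+y≡0 = n∣m⇒m%n≡0 (x + y) z z∣x+y

  %-*-cong : ∀ q {x y} → x % z ≡ y % z → (q * x) % z ≡ (q * y) % z
  %-*-cong q {x} {y} eq = trans (%-distribˡ-* q x z) (trans (cong (λ t → ((q % z) * t) % z) eq) (sym (%-distribˡ-* q y z)))

  ∣-∸1⇒%-* : ∀ q .{{_ : NonZero q}} x → z ∣ q ∸ 1 → (q * x) % z ≡ x % z
  ∣-∸1⇒%-* (suc q) x z∣q = %-remove-+ʳ x (∣m⇒∣m*n x z∣q)

  ∣-∸1-^ : ∀ q .{{_ : NonZero q}} k → z ∣ q ∸ 1 → z ∣ q ^ k ∸ 1
  ∣-∸1-^ q zero _ = z ∣0
  ∣-∸1-^ (suc q) (suc k) z∣q = subst (z ∣_) eq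
    (∣m∣n⇒∣m+n (∣-∸1-^ (suc q) k z∣q) (∣m⇒∣m*n (suc q ^ k) z∣q))
    where
    eq : (suc q ^ k ∸ 1) + q * suc q ^ k ≡ suc q ^ suc k ∸ 1
    eq = sym (+-∸-comm (q * suc q ^ k) (m^n>0 (suc q) k))

-- Sums of floors and residues along geometric progressions.

-- The sum of g(p^i m) over i < k, with the powers of p absorbed into the argument.
geoSum : (ℕ → ℕ) → ℕ → ℕ → ℕ → ℕ
geoSum g p zero m = 0
geoSum g p (suc k) m = g m + geoSum g p k (p * m)

geometric : ℕ → ℕ → ℕ
geometric p zero = 0
geometric p (suc k) = 1 + p * geometric p k

geometric-^ : ∀ p .{{_ : NonZero p}} k → (p ∸ 1) * geometric p k + 1 ≡ p ^ k
geometric-^ (suc c) zero = cong (_+ 1) (*-zeroʳ c)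
geometric-^ (suc c) (suc k) = trans (regroup c (geometric (suc c) k)) (cong (suc c *_) (geometric-^ (suc c) k))
  where
  regroup : ∀ c g → c * (1 + suc c * g) + 1 ≡ suc c * (c * g + 1)
  regroup = solve-∀

module _ (p z : ℕ) .{{_ : NonZero z}} where

  geoSum-/% : ∀ k m → z * geoSum (_/ z) p k m + geoSum (_% z) p k m ≡ m * geometric p k
  geoSum-/% zero m = trans (+-identityʳ _) (trans (*-zeroʳ z) (sym (*-zeroʳ m)))
  geoSum-/% (suc k) m = begin
    z * (m / z + geoSum (_/ z) p k (p * m)) + (m % z + geoSum (_% z) p k (p * m))
      ≡⟨ regroup z (m / z) (geoSum (_/ z) p k (p * m)) (m % z) _ ⟩
    (m % z + m / z * z) + (z * geoSum (_/ z) p k (p * m) + geoSum (_% z) p k (p * m))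
      ≡⟨ cong₂ _+_ (sym (m≡m%n+[m/n]*n m z)) (geoSum-/% k (p * m)) ⟩
    m + p * m * geometric p k
      ≡⟨ regroup′ m p (geometric p k) ⟩
    m * (1 + p * geometric p k) ∎
    where
    open ≡-Reasoning
    regroup : ∀ z a b c d → z * (a + b) + (c + d) ≡ (c + a * z) + (z * b + d)
    regroup = solve-∀
    regroup′ : ∀ m p g → m + p * m * g ≡ m * (1 + p * g)
    regroup′ = solve-∀

  geoSum-%-cong : ∀ k {x y} → x % z ≡ y % z → geoSum (_% z) p k x ≡ geoSum (_% z) p k y
  geoSum-%-cong zero _ = refl
  geoSum-%-cong (suc k) eq = cong₂ _+_ eq (geoSum-%-cong k (%-*-cong z p eq))

  geoSum-%-∣ : ∀ k {m} → z ∣ m → geoSum (_% z) p k m ≡ 0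
  geoSum-%-∣ zero _ = refl
  geoSum-%-∣ (suc k) {m} z∣m = cong₂ _+_ (n∣m⇒m%n≡0 m z z∣m) (geoSum-%-∣ k (∣n⇒∣m*n p z∣m))

  geoSum-%-const : .{{_ : NonZero p}} → z ∣ p ∸ 1 → ∀ k m → geoSum (_% z) p k m ≡ k * (m % z)
  geoSum-%-const z∣c zero m = refl
  geoSum-%-const z∣c (suc k) m = cong (λ t → m % z + t) (trans (geoSum-%-const z∣c k (p * m)) (cong (k *_) (∣-∸1⇒%-* z p m z∣c)))

  module _ (z∣1+p : z ∣ suc p) where

    %-p² : ∀ m → (p * (p * m)) % z ≡ m % z
    %-p² m = begin
      (p * (p * m)) % z                  ≡⟨ %-remove-+ʳ (p * (p * m)) (∣m⇒∣m*n m z∣1+p) ⟨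
      (p * (p * m) + suc p * m) % z      ≡⟨ cong (_% z) (regroup p m) ⟩
      (m + suc p * (p * m)) % z          ≡⟨ %-remove-+ʳ m (∣m⇒∣m*n (p * m) z∣1+p) ⟩
      m % z                              ∎
      where
      open ≡-Reasoning
      regroup : ∀ p m → p * (p * m) + suc p * m ≡ m + suc p * (p * m)
      regroup = solve-∀

    %-p^even : ∀ k m → (p ^ (k * 2) * m) % z ≡ m % z
    %-p^even zero m = cong (_% z) (*-identityˡ m)
    %-p^even (suc k) m = trans (cong (_% z) (regroup p (p ^ (k * 2)) m)) (trans (%-p² (p ^ (k * 2) * m)) (%-p^even k m))
      where
      regroup : ∀ p q m → p * (p * q) * m ≡ p * (p * (q * m))
      regroup = solve-∀

    -- The residues have period two, and two neighbours add up to z, or to 0 if z divides m; b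
    -- counts the terms left after pairing.
    geoSum-%-alternating : ∀ k b m → geoSum (_% z) p (k * 2 + b) m ≡ k * (z * [ ¬? (m % z ≟ 0) ]) + geoSum (_% z) p b m
    geoSum-%-alternating zero b m = refl
    geoSum-%-alternating (suc k) b m = begin
      m % z + ((p * m) % z + geoSum (_% z) p (k * 2 + b) (p * (p * m)))
        ≡⟨ +-assoc (m % z) _ _ ⟨
      (m % z + (p * m) % z) + geoSum (_% z) p (k * 2 + b) (p * (p * m))
        ≡⟨ cong₂ _+_ (%-complement z m (p * m) (∣m⇒∣m*n m z∣1+p)) (geoSum-%-cong (k * 2 + b) (%-p² m)) ⟩
      c + geoSum (_% z) p (k * 2 + b) m
        ≡⟨ cong (λ t → c + t) (geoSum-%-alternating k b m) ⟩
      c + (k * c + geoSum (_% z) p b m)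
        ≡⟨ +-assoc c _ _ ⟨
      suc k * c + geoSum (_% z) p b m ∎
      where
      open ≡-Reasoning
      c : ℕ
      c = z * [ ¬? (m % z ≟ 0) ]

    ∣-p^even∸1 : .{{_ : NonZero p}} → ∀ k → z ∣ p ^ (k * 2) ∸ 1
    ∣-p^even∸1 k = subst (λ t → z ∣ t ∸ 1) (trans (^-*-assoc p 2 k) (cong (p ^_) (*-comm 2 k)))
      (∣-∸1-^ z (p ^ 2) {{m^n≢0 p 2}} k z∣p²)
      where
      factor : ∀ p .{{_ : NonZero p}} → p ^ 2 ∸ 1 ≡ (p ∸ 1) * suc p
      factor (suc c) = regroup c
        where
        regroup : ∀ c → c * 1 + c * suc (c * 1) ≡ c * suc (suc c)
        regroup = solve-∀
      z∣p² : z ∣ p ^ 2 ∸ 1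
      z∣p² = subst (z ∣_) (sym (factor p)) (∣n⇒∣m*n (p ∸ 1) z∣1+p)

    ∣-geometric-even : ∀ k → z ∣ geometric p (k * 2)
    ∣-geometric-even zero = z ∣0
    ∣-geometric-even (suc k) = subst (z ∣_) (regroup p (geometric p (k * 2)))
      (∣m∣n⇒∣m+n z∣1+p (∣n⇒∣m*n (p * p) (∣-geometric-even k)))
      where
      regroup : ∀ p g → suc p + p * p * g ≡ 1 + p * (1 + p * g)
      regroup = solve-∀

module _ {p : ℕ} (pp : Prime p) (z : ℕ) .{{_ : NonZero z}} where

  private instance
    p≢0 : NonZero p
    p≢0 = prime⇒nonZero pp

  -- Because ⌊⌊p x / z⌋ / p⌋ = ⌊x / z⌋, the floors do not nest as the recursion is repeated. It
  -- serves for p^a n and for n(p^a - 1) = p^v m.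
  ν-factorial-geoSum : ∀ k m → ν p (((p ^ k * m) / z) !) ≡ geoSum (_/ z) p k m + ν p ((m / z) !)
  ν-factorial-geoSum zero m = cong (λ t → ν p ((t / z) !)) (*-identityˡ m)
  ν-factorial-geoSum (suc k) m = begin
    ν p (((p ^ suc k * m) / z) !)
      ≡⟨ cong (λ t → ν p ((t / z) !)) (regroup p (p ^ k) m) ⟩
    ν p (((p ^ k * (p * m)) / z) !)
      ≡⟨ ν-factorial-geoSum k (p * m) ⟩
    geoSum (_/ z) p k (p * m) + ν p (((p * m) / z) !)
      ≡⟨ cong (λ t → geoSum (_/ z) p k (p * m) + t) (ν-factorial pp ((p * m) / z)) ⟩
    geoSum (_/ z) p k (p * m) + ((p * m) / z / p + ν p (((p * m) / z / p) !))
      ≡⟨ cong (λ t → geoSum (_/ z) p k (p * m) + (t + ν p (t !))) floor-nested ⟩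
    geoSum (_/ z) p k (p * m) + (m / z + ν p ((m / z) !))
      ≡⟨ regroup′ (geoSum (_/ z) p k (p * m)) (m / z) _ ⟩
    m / z + geoSum (_/ z) p k (p * m) + ν p ((m / z) !) ∎
    where
    open ≡-Reasoning
    regroup : ∀ p q m → p * q * m ≡ q * (p * m)
    regroup = solve-∀
    regroup′ : ∀ a b c → a + (b + c) ≡ b + a + c
    regroup′ = solve-∀
    instance
      zp≢0 : NonZero (z * p)
      zp≢0 = m*n≢0 z p
      pz≢0 : NonZero (p * z)
      pz≢0 = m*n≢0 p z
    floor-nested : (p * m) / z / p ≡ m / z
    floor-nested = begin
      (p * m) / z / p     ≡⟨ m/n/o≡m/[n*o] (p * m) z p ⟩
      (p * m) / (z * p)   ≡⟨ /-congʳ (*-comm z p) ⟩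
      (p * m) / (p * z)   ≡⟨ m*n/m*o≡n/o p m z ⟩
      m / z               ∎

-- The valuation of the Fibonomial coefficient in the three cases.

odd-decomposition : ∀ a → ¬ 2 ∣ a → a ≡ ⌊ a /2⌋ * 2 + 1
odd-decomposition zero ¬2∣a = contradiction (2 ∣0) ¬2∣a
odd-decomposition (suc zero) _ = refl
odd-decomposition (suc (suc a)) ¬2∣a = cong (λ t → suc (suc t)) (odd-decomposition a (λ 2∣a → ¬2∣a (∣m∣n⇒∣m+n ∣-refl 2∣a)))

⌊k*2/2⌋ : ∀ k → ⌊ k * 2 /2⌋ ≡ k
⌊k*2/2⌋ zero = refl
⌊k*2/2⌋ (suc k) = cong suc (⌊k*2/2⌋ k)

parity-decomposition : ∀ v → v ≡ ⌊ v /2⌋ * 2 + [ ¬? (2 ∣? v) ]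
parity-decomposition v with 2 ∣? v
... | yes (divides k eq) = trans eq (trans (cong (_* 2) (sym (trans (cong ⌊_/2⌋ eq) (⌊k*2/2⌋ k)))) (sym (+-identityʳ _)))
... | no ¬2∣v = odd-decomposition v ¬2∣v

module _ {p : ℕ} (pp : Prime p) (p≢2 : p ≢ 2) (z : ℕ) .{{_ : NonZero z}} (rank : IsRankOfAppearance p z)
         (a n n′ : ℕ) .{{_ : NonZero n}} (n≡ : n ≡ p ^ ν p n * n′) where

  private
    instance
      p≢0 : NonZero p
      p≢0 = prime⇒nonZero pp
      p>1 : NonTrivial p
      p>1 = prime⇒nonTrivial pp
      c≢0 : NonZero (p ∸ 1)
      c≢0 = >-nonZero (m<n⇒0<n∸m (nonTrivial⇒n>1 p))
    v c q m l A X E N r s nz S₁ S₂ R₁ R₂ : ℕ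
    v = ν p n
    c = p ∸ 1
    q = p ^ a
    m = n′ * (q ∸ 1)
    l = n * (q ∸ 1)
    A = m / z
    X = n′ * geometric p a
    E = ν p (A !)
    N = ν p (fibonomial (q * n) n)
    r = (q * n) % z
    s = n % z
    nz = ν p (F z)
    S₁ = geoSum (_/ z) p a n
    S₂ = geoSum (_/ z) p v m
    R₁ = geoSum (_% z) p a n
    R₂ = geoSum (_% z) p v m

    q* : ∀ x → q * x ≡ x + x * (q ∸ 1)
    q* x = trans (cong (_* x) (sym (suc-pred q {{m^n≢0 p a}}))) (cong (λ t → x + t) (*-comm (q ∸ 1) x))

    l≡ : l ≡ p ^ v * m
    l≡ = trans (cong (_* (q ∸ 1)) n≡) (*-assoc (p ^ v) n′ (q ∸ 1))

    q∸1≡ : q ∸ 1 ≡ c * geometric p a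
    q∸1≡ = trans (cong (_∸ 1) (sym (geometric-^ p a))) (m+n∸n≡m _ 1)

    cX≡m : c * X ≡ m
    cX≡m = trans (regroup c n′ (geometric p a)) (cong (n′ *_) (sym q∸1≡))
      where
      regroup : ∀ c n g → c * (n * g) ≡ n * (c * g)
      regroup = solve-∀

    -- The bracket is the carry in p^a n = n + l. The floors of n / z and l / z cancel, and so does
    -- the factorial of ⌊n / z⌋, which ends the expansion for p^a n and also occurs in F_1 ⋯ F_n.
    ν-fibonomial-geoSum : N + (S₂ + E) ≡ nz * [ r <? s ] + S₁
    ν-fibonomial-geoSum = +-cancelʳ-≡ (nz * (n / z) + nz * (l / z) + e₂) _ _ (begin
      N + (S₂ + E) + (nz * (n / z) + nz * (l / z) + e₂)
        ≡⟨ regroup N (S₂ + E) (nz * (n / z)) (nz * (l / z)) e₂ ⟩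
      N + ((nz * (n / z) + e₂) + (nz * (l / z) + (S₂ + E)))
        ≡⟨ cong (λ t → N + ((nz * (n / z) + e₂) + (nz * (l / z) + t))) e₃≡ ⟨
      N + ((nz * (n / z) + e₂) + (nz * (l / z) + ν p ((l / z) !)))
        ≡⟨ cong (λ t → N + t) (cong₂ _+_ (ν-fibFact pp rank p≢2 n) (ν-fibFact pp rank p≢2 l)) ⟨
      N + (ν p (fibFact n) + ν p (fibFact l))
        ≡⟨ cong (λ t → ν p (fibonomial t n) + (ν p (fibFact n) + ν p (fibFact l))) (q* n) ⟩
      ν p (fibonomial (n + l) n) + (ν p (fibFact n) + ν p (fibFact l))
        ≡⟨ ν-fibonomial pp n l ⟩
      ν p (fibFact (n + l))
        ≡⟨ cong (λ t → ν p (fibFact t)) (q* n) ⟨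
      ν p (fibFact (q * n))
        ≡⟨ ν-fibFact pp rank p≢2 (q * n) ⟩
      nz * ((q * n) / z) + ν p (((q * n) / z) !)
        ≡⟨ cong₂ (λ x y → nz * x + y) carry (ν-factorial-geoSum pp z a n) ⟩
      nz * (n / z + l / z + [ r <? s ]) + (S₁ + e₂)
        ≡⟨ regroup′ nz (n / z) (l / z) [ r <? s ] S₁ e₂ ⟩
      nz * [ r <? s ] + S₁ + (nz * (n / z) + nz * (l / z) + e₂) ∎)
      where
      open ≡-Reasoning
      e₂ : ℕ
      e₂ = ν p ((n / z) !)
      e₃≡ : ν p ((l / z) !) ≡ S₂ + E
      e₃≡ = trans (cong (λ t → ν p ((t / z) !)) l≡) (ν-factorial-geoSum pp z v m)
      carry : (q * n) / z ≡ n / z + l / z + [ r <? s ]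
      carry = subst (λ t → t / z ≡ n / z + l / z + [ t % z <? s ]) (sym (q* n)) (proj₁ (/%-carry z n l))
      regroup : ∀ N S x y e → N + S + (x + y + e) ≡ N + ((x + e) + (y + S))
      regroup = solve-∀
      regroup′ : ∀ f x y b S e → f * (x + y + b) + (S + e) ≡ f * b + S + (f * x + f * y + e)
      regroup′ = solve-∀

    ν-fibonomial-residues : z * (N + E) + R₁ ≡ z * (nz * [ r <? s ]) + (X + R₂)
    ν-fibonomial-residues = +-cancelʳ-≡ (z * S₂) _ _ (begin
      z * (N + E) + R₁ + z * S₂
        ≡⟨ regroup z N E R₁ S₂ ⟩
      z * (N + (S₂ + E)) + R₁
        ≡⟨ cong (λ t → z * t + R₁) ν-fibonomial-geoSum ⟩
      z * (nz * [ r <? s ] + S₁) + R₁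
        ≡⟨ regroup′ z (nz * [ r <? s ]) S₁ R₁ ⟩
      z * (nz * [ r <? s ]) + (z * S₁ + R₁)
        ≡⟨ cong (λ t → z * (nz * [ r <? s ]) + t) (geoSum-/% p z a n) ⟩
      z * (nz * [ r <? s ]) + n * geometric p a
        ≡⟨ cong (λ t → z * (nz * [ r <? s ]) + t) total ⟩
      z * (nz * [ r <? s ]) + (X + (z * S₂ + R₂))
        ≡⟨ regroup″ (z * (nz * [ r <? s ])) X (z * S₂) R₂ ⟩
      z * (nz * [ r <? s ]) + (X + R₂) + z * S₂ ∎)
      where
      open ≡-Reasoning
      regroup : ∀ z N E R S → z * (N + E) + R + z * S ≡ z * (N + (S + E)) + R
      regroup = solve-∀
      regroup′ : ∀ z b S R → z * (b + S) + R ≡ z * b + (z * S + R)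
      regroup′ = solve-∀
      regroup″ : ∀ w x y r → w + (x + (y + r)) ≡ w + (x + r) + y
      regroup″ = solve-∀
      regroup‴ : ∀ c g n h → (c * g + 1) * n * h ≡ n * h + n * (c * h) * g
      regroup‴ = solve-∀
      -- With p^v = (p - 1)(1 + ⋯ + p^{v-1}) + 1, the progression of n splits into X and the
      -- progression of m, so the floors in `S₂` cancel.
      total : n * geometric p a ≡ X + (z * S₂ + R₂)
      total = begin
        n * geometric p a
          ≡⟨ cong (_* geometric p a) (trans n≡ (cong (_* n′) (sym (geometric-^ p v)))) ⟩
        (c * geometric p v + 1) * n′ * geometric p a
          ≡⟨ regroup‴ c (geometric p v) n′ (geometric p a) ⟩
        X + n′ * (c * geometric p a) * geometric p v
          ≡⟨ cong (λ t → X + n′ * t * geometric p v) q∸1≡ ⟨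
        X + m * geometric p v
          ≡⟨ cong (λ t → X + t) (geoSum-/% p z v m) ⟨
        X + (z * S₂ + R₂) ∎

    ν-fibonomial-∣ : z ∣ q ∸ 1 → c * (z * (N + E) + R₁) ≡ z * A
    ν-fibonomial-∣ z∣q = begin
      c * (z * (N + E) + R₁)                            ≡⟨ cong (c *_) ν-fibonomial-residues ⟩
      c * (z * (nz * [ r <? s ]) + (X + R₂))            ≡⟨ cong₂ (λ x y → c * (z * (nz * x) + (X + y))) r≮s (geoSum-%-∣ p z v z∣m) ⟩
      c * (z * (nz * 0) + (X + 0))                      ≡⟨ regroup c z nz X ⟩
      c * X                                             ≡⟨ cX≡m ⟩
      m                                                 ≡⟨ m*[n/m]≡n z∣m ⟨
      z * A                                             ∎
      where
      open ≡-Reasoning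
      z∣m : z ∣ m
      z∣m = ∣n⇒∣m*n n′ z∣q
      r≮s : [ r <? s ] ≡ 0
      r≮s = []-no _ (≤⇒≯ (≤-reflexive (sym (trans (cong (_% z) (q* n)) (%-remove-+ʳ n (∣n⇒∣m*n n z∣q))))))
      regroup : ∀ c z f X → c * (z * (f * 0) + (X + 0)) ≡ c * X
      regroup = solve-∀

  -- As p ≡ 1 modulo z, all p^i n share the residue of n′, which is z times the fractional part in
  -- (i).
  ν-fibonomial-split : z ∣ p ∸ 1 → c * (z * (N + E) + a * (n′ % z)) ≡ z * A
  ν-fibonomial-split z∣c = trans
    (cong (λ t → c * (z * (N + E) + t)) (sym (trans (geoSum-%-const p z z∣c a n) (cong (a *_) s≡))))
    (ν-fibonomial-∣ (∣-∸1-^ z p a z∣c))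
    where
    s≡ : n % z ≡ n′ % z
    s≡ = trans (cong (_% z) n≡) (∣-∸1⇒%-* z (p ^ v) {{m^n≢0 p v}} n′ (∣-∸1-^ z p v z∣c))

  ν-fibonomial-inert-even : z ∣ suc p → ∀ h → a ≡ h * 2 → c * (N + E + h * [ ¬? (s ≟ 0) ]) ≡ A
  ν-fibonomial-inert-even z∣1+p h a≡ = *-cancelˡ-≡ _ _ z (trans (trans (regroup z c (N + E) h [ ¬? (s ≟ 0) ])
    (cong (λ t → c * (z * (N + E) + t)) (sym R₁≡)))
    (ν-fibonomial-∣ (subst (λ t → z ∣ p ^ t ∸ 1) (sym a≡) (∣-p^even∸1 p z z∣1+p h))))
    where
    regroup : ∀ z c w h b → z * (c * (w + h * b)) ≡ c * (z * w + h * (z * b))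
    regroup = solve-∀
    R₁≡ : R₁ ≡ h * (z * [ ¬? (s ≟ 0) ])
    R₁≡ = trans (cong (λ t → geoSum (_% z) p t n) (trans a≡ (sym (+-identityʳ (h * 2)))))
      (trans (geoSum-%-alternating p z z∣1+p h 0 n) (+-identityʳ _))

  -- From m = (p - 1) X one gets ⌊A/(p - 1)⌋ = ⌊X / z⌋. After the paired residues are split off,
  -- what remains to be compared is the residue of X, the unpaired s, and for odd v an unpaired
  -- residue of m.
  ν-fibonomial-inert-odd : z ∣ suc p → ∀ h → a ≡ h * 2 + 1 →
    N + E + h * [ ¬? (s ≟ 0) ]
      ≡ A / c + (⌊ v /2⌋ * [ ¬? (r ≟ s) ] + [ ¬? (2 ∣? v) ] * [ s <? r ] + [ r <? s ] * nz)
  ν-fibonomial-inert-odd z∣1+p h a≡ = *-cancelˡ-≡ _ _ z (+-cancelʳ-≡ s _ _ (begin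
    z * (N + E + h * [ ¬? (s ≟ 0) ]) + s
      ≡⟨ regroup₁ z (N + E) h [ ¬? (s ≟ 0) ] s ⟩
    z * (N + E) + (h * (z * [ ¬? (s ≟ 0) ]) + (s + 0))
      ≡⟨ cong (λ t → z * (N + E) + t) (trans (cong (λ t → geoSum (_% z) p t n) a≡) (geoSum-%-alternating p z z∣1+p h 1 n)) ⟨
    z * (N + E) + R₁
      ≡⟨ ν-fibonomial-residues ⟩
    z * (nz * [ r <? s ]) + (X + R₂)
      ≡⟨ cong₂ (λ x y → z * (nz * [ r <? s ]) + (x + y)) X≡ R₂≡ ⟩
    z * (nz * [ r <? s ]) + ((s′ + A / c * z) + (k * (z * [ ¬? (t ≟ 0) ]) + b * t))
      ≡⟨ regroup₂ z (nz * [ r <? s ]) s′ (A / c) k [ ¬? (t ≟ 0) ] (b * t) ⟩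
    z * (A / c + k * [ ¬? (t ≟ 0) ] + nz * [ r <? s ]) + (s′ + b * t)
      ≡⟨ cong₂ (λ x y → z * (A / c + k * x + nz * [ r <? s ]) + y) t≢0 s′+bt ⟩
    z * (A / c + k * [ ¬? (r ≟ s) ] + nz * [ r <? s ]) + (s + z * (b * [ s <? r ]))
      ≡⟨ regroup₃ z (A / c) (k * [ ¬? (r ≟ s) ]) nz [ r <? s ] s (b * [ s <? r ]) ⟩
    z * (A / c + (k * [ ¬? (r ≟ s) ] + b * [ s <? r ] + [ r <? s ] * nz)) + s ∎))
    where
    open ≡-Reasoning
    k b t s′ r′ : ℕ
    k = ⌊ v /2⌋
    b = [ ¬? (2 ∣? v) ]
    t = m % z
    s′ = n′ % z
    r′ = (q * n′) % z

    regroup₁ : ∀ z w h x s → z * (w + h * x) + s ≡ z * w + (h * (z * x) + (s + 0))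
    regroup₁ = solve-∀
    regroup₂ : ∀ z w s Y k x y → z * w + ((s + Y * z) + (k * (z * x) + y)) ≡ z * (Y + k * x + w) + (s + y)
    regroup₂ = solve-∀
    regroup₃ : ∀ z Y k f x s y → z * (Y + k + f * x) + (s + z * y) ≡ z * (Y + (k + y + x * f)) + s
    regroup₃ = solve-∀

    A/c≡ : A / c ≡ X / z
    A/c≡ = begin
      m / z / c              ≡⟨ cong (λ x → x / z / c) cX≡m ⟨
      (c * X) / z / c        ≡⟨ m/n/o≡m/[n*o] (c * X) z c ⟩
      (c * X) / (z * c)      ≡⟨ /-congʳ (*-comm z c) ⟩
      (c * X) / (c * z)      ≡⟨ m*n/m*o≡n/o c X z ⟩
      X / z                  ∎
      where
      instance
        zc≢0 : NonZero (z * c)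
        zc≢0 = m*n≢0 z c
        cz≢0 : NonZero (c * z)
        cz≢0 = m*n≢0 c z

    -- For odd a the sum 1 + p + ⋯ + p^{a-1} is 1 modulo z: the powers after the first pair off into
    -- multiples of 1 + p.
    X%z : X % z ≡ s′
    X%z = begin
      (n′ * geometric p a) % z                            ≡⟨ cong (λ x → (n′ * geometric p x) % z) (trans a≡ (+-comm (h * 2) 1)) ⟩
      (n′ * (1 + p * geometric p (h * 2))) % z            ≡⟨ cong (_% z) (*-suc n′ _) ⟩
      (n′ + n′ * (p * geometric p (h * 2))) % z           ≡⟨ %-remove-+ʳ n′ (∣n⇒∣m*n n′ (∣n⇒∣m*n p (∣-geometric-even p z z∣1+p h))) ⟩
      s′                                                  ∎

    X≡ : X ≡ s′ + A / c * z
    X≡ = trans (m≡m%n+[m/n]*n X z) (cong₂ (λ x y → x + y * z) X%z (sym A/c≡))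

    geoSum-b : geoSum (_% z) p b m ≡ b * t
    geoSum-b with 2 ∣? v
    ... | yes _ = refl
    ... | no _ = refl

    R₂≡ : R₂ ≡ k * (z * [ ¬? (t ≟ 0) ]) + b * t
    R₂≡ = trans (cong (λ x → geoSum (_% z) p x m) (parity-decomposition v))
      (trans (geoSum-%-alternating p z z∣1+p k b m) (cong (λ x → k * (z * [ ¬? (t ≟ 0) ]) + x) geoSum-b))

    -- The carry in p^a n′ = n′ + m.
    s′+t : s′ + t ≡ r′ + z * [ r′ <? s′ ]
    s′+t = subst (λ x → s′ + t ≡ x % z + z * [ x % z <? s′ ]) (sym (q* n′)) (proj₂ (/%-carry z n′ m))

    t≡0⇒r′≡s′ : t ≡ 0 → r′ ≡ s′
    t≡0⇒r′≡s′ t≡0 = trans (cong (_% z) (q* n′)) (%-remove-+ʳ n′ (m%n≡0⇒n∣m m z t≡0))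

    r′≡s′⇒t≡0 : r′ ≡ s′ → t ≡ 0
    r′≡s′⇒t≡0 r′≡s′ = +-cancelˡ-≡ s′ t 0 (trans s′+t (trans (cong₂ (λ x y → x + z * y) r′≡s′ ([]-no _ (≤⇒≯ (≤-reflexive (sym r′≡s′))))) (cong (λ t → s′ + t) (*-zeroʳ z))))

    -- Multiplication by p negates residues modulo z, so the parity of v decides which of r, s is the residue of n′.
    residues : (b ≡ 0 × s′ ≡ s × r′ ≡ r) ⊎ (b ≡ 1 × s′ ≡ r × r′ ≡ s)
    residues with b in b≡ | parity-decomposition v
    ... | zero | v≡ = inj₁ (refl , sym s≡ , (begin
        (q * n′) % z     ≡⟨ %-*-cong z q s≡ ⟨
        (q * n) % z      ∎))
      where
      s≡ : n % z ≡ n′ % z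
      s≡ = begin
        n % z                       ≡⟨ cong (_% z) n≡ ⟩
        (p ^ v * n′) % z            ≡⟨ cong (λ x → (p ^ x * n′) % z) (trans v≡ (+-identityʳ (k * 2))) ⟩
        (p ^ (k * 2) * n′) % z      ≡⟨ %-p^even p z z∣1+p k n′ ⟩
        n′ % z                      ∎
    ... | suc zero | v≡ = inj₂ (refl , sym r≡ , trans (q-% n′) (sym s≡))
      where
      q-% : ∀ x → (q * x) % z ≡ (p * x) % z
      q-% x = begin
        (p ^ a * x) % z                  ≡⟨ cong (λ y → (p ^ y * x) % z) a≡ ⟩
        (p ^ (h * 2 + 1) * x) % z        ≡⟨ cong (λ y → (y * x) % z) (^-distribˡ-+-* p (h * 2) 1) ⟩
        (p ^ (h * 2) * p ^ 1 * x) % z    ≡⟨ cong (_% z) (regroup (p ^ (h * 2)) p x) ⟩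
        (p ^ (h * 2) * (p * x)) % z      ≡⟨ %-p^even p z z∣1+p h (p * x) ⟩
        (p * x) % z                      ∎
        where
        regroup : ∀ y p x → y * (p * 1) * x ≡ y * (p * x)
        regroup = solve-∀
      s≡ : n % z ≡ (p * n′) % z
      s≡ = begin
        n % z                             ≡⟨ cong (_% z) n≡ ⟩
        (p ^ v * n′) % z                  ≡⟨ cong (λ y → (p ^ y * n′) % z) v≡ ⟩
        (p ^ (k * 2 + 1) * n′) % z        ≡⟨ cong (λ y → (y * n′) % z) (^-distribˡ-+-* p (k * 2) 1) ⟩
        (p ^ (k * 2) * p ^ 1 * n′) % z    ≡⟨ cong (_% z) (regroup (p ^ (k * 2)) p n′) ⟩
        (p ^ (k * 2) * (p * n′)) % z      ≡⟨ %-p^even p z z∣1+p k (p * n′) ⟩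
        (p * n′) % z                      ∎
        where
        regroup : ∀ y p x → y * (p * 1) * x ≡ y * (p * x)
        regroup = solve-∀
      r≡ : (q * n) % z ≡ n′ % z
      r≡ = begin
        (q * n) % z            ≡⟨ q-% n ⟩
        (p * n) % z            ≡⟨ %-*-cong z p s≡ ⟩
        (p * (p * n′)) % z     ≡⟨ %-p² p z z∣1+p n′ ⟩
        n′ % z                 ∎
    ... | suc (suc _) | _ = contradiction b≡ (bracket≤1 (¬? (2 ∣? v)))
      where
      bracket≤1 : ∀ {P : Set} (d : Dec P) {j} → [ d ] ≢ suc (suc j)
      bracket≤1 (yes _) ()
      bracket≤1 (no _) ()

    t≢0 : [ ¬? (t ≟ 0) ] ≡ [ ¬? (r ≟ s) ]
    t≢0 = []-cong _ _ (λ t≢0 r≡s → t≢0 (r′≡s′⇒t≡0 (to r≡s))) (λ r≢s t≡0 → r≢s (from (t≡0⇒r′≡s′ t≡0)))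
      where
      to : r ≡ s → r′ ≡ s′
      to r≡s with residues
      ... | inj₁ (_ , s′≡ , r′≡) = trans r′≡ (trans r≡s (sym s′≡))
      ... | inj₂ (_ , s′≡ , r′≡) = trans r′≡ (trans (sym r≡s) (sym s′≡))
      from : r′ ≡ s′ → r ≡ s
      from r′≡s′ with residues
      ... | inj₁ (_ , s′≡ , r′≡) = trans (sym r′≡) (trans r′≡s′ s′≡)
      ... | inj₂ (_ , s′≡ , r′≡) = trans (sym s′≡) (trans (sym r′≡s′) r′≡)

    -- For even v nothing is unpaired and s′ = s. For odd v the roles of r and s are exchanged, and
    -- the carry in n′ + m becomes the bracket of s < r.
    s′+bt : s′ + b * t ≡ s + z * (b * [ s <? r ])
    s′+bt with residues
    ... | inj₁ (b≡ , s′≡ , _) = trans (cong₂ (λ x y → x + y * t) s′≡ b≡)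
            (sym (trans (cong (λ x → s + z * (x * [ s <? r ])) b≡) (cong (λ t → s + t) (*-zeroʳ z))))
    ... | inj₂ (b≡ , s′≡ , r′≡) = begin
      s′ + b * t                       ≡⟨ cong (λ x → s′ + x * t) b≡ ⟩
      s′ + 1 * t                       ≡⟨ cong (λ t → s′ + t) (*-identityˡ t) ⟩
      s′ + t                           ≡⟨ s′+t ⟩
      r′ + z * [ r′ <? s′ ]            ≡⟨ cong₂ (λ x y → x + z * [ x <? y ]) r′≡ s′≡ ⟩
      s + z * [ s <? r ]               ≡⟨ cong (λ x → s + z * x) (trans (cong (_* [ s <? r ]) b≡) (*-identityˡ _)) ⟨
      s + z * (b * [ s <? r ])         ∎

-- Passage from natural-number identities to ℚ and ℤ.

toℚᵘ-÷ : ∀ x d → toℚᵘ (x ÷ suc d) ≃ mkℚᵘ (+ x) d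
toℚᵘ-÷ x d = ℚₚ.toℚᵘ-fromℚᵘ (mkℚᵘ (+ x) d)

÷-cong : ∀ x d y e .{{_ : NonZero d}} .{{_ : NonZero e}} → x * e ≡ y * d → x ÷ d ≡ y ÷ e
÷-cong x (suc d) y (suc e) eq = ℚₚ.fromℚᵘ-cong {mkℚᵘ (+ x) d} {mkℚᵘ (+ y) e}
  (*≡* (trans (sym (ℤₚ.pos-* x (suc e))) (trans (cong +_ eq) (ℤₚ.pos-* y (suc d)))))

÷-+ : ∀ x d y e .{{_ : NonZero d}} .{{_ : NonZero e}} → x ÷ d +ℚ y ÷ e ≡ (x * e + y * d) ÷ (d * e)
÷-+ x (suc d) y (suc e) = ℚₚ.toℚᵘ-injective (begin
  toℚᵘ (x ÷ suc d +ℚ y ÷ suc e)              ≈⟨ ℚₚ.toℚᵘ-homo-+ (x ÷ suc d) (y ÷ suc e) ⟩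
  toℚᵘ (x ÷ suc d) ℚᵘ.+ toℚᵘ (y ÷ suc e)     ≈⟨ ℚᵘₚ.+-cong (toℚᵘ-÷ x d) (toℚᵘ-÷ y e) ⟩
  mkℚᵘ (+ x) d ℚᵘ.+ mkℚᵘ (+ y) e             ≡⟨ cong (λ t → mkℚᵘ t _) (trans (ℤₚ.pos-+ (x * suc e) (y * suc d)) (cong₂ _+ℤ_ (ℤₚ.pos-* x (suc e)) (ℤₚ.pos-* y (suc d)))) ⟨
  mkℚᵘ (+ (x * suc e + y * suc d)) _         ≈⟨ toℚᵘ-÷ (x * suc e + y * suc d) _ ⟨
  toℚᵘ ((x * suc e + y * suc d) ÷ (suc d * suc e)) ∎)
  where
  open SetoidReasoning ℚᵘₚ.≃-setoid

÷-* : ∀ x d y e .{{_ : NonZero d}} .{{_ : NonZero e}} → (x ÷ d) *ℚ (y ÷ e) ≡ (x * y) ÷ (d * e)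
÷-* x (suc d) y (suc e) = ℚₚ.toℚᵘ-injective (begin
  toℚᵘ (x ÷ suc d *ℚ y ÷ suc e)              ≈⟨ ℚₚ.toℚᵘ-homo-* (x ÷ suc d) (y ÷ suc e) ⟩
  toℚᵘ (x ÷ suc d) ℚᵘ.* toℚᵘ (y ÷ suc e)     ≈⟨ ℚᵘₚ.*-cong (toℚᵘ-÷ x d) (toℚᵘ-÷ y e) ⟩
  mkℚᵘ (+ x) d ℚᵘ.* mkℚᵘ (+ y) e             ≡⟨ cong (λ t → mkℚᵘ t _) (ℤₚ.pos-* x y) ⟨
  mkℚᵘ (+ (x * y)) _                         ≈⟨ toℚᵘ-÷ (x * y) _ ⟨
  toℚᵘ ((x * y) ÷ (suc d * suc e)) ∎)
  where
  open SetoidReasoning ℚᵘₚ.≃-setoid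

+⇒- : ∀ {x y w} → x +ℚ y ≡ w → x ≡ w -ℚ y
+⇒- {x} {y} refl = sym (trans (ℚₚ.+-assoc x y (ℚ.- y)) (trans (cong (x +ℚ_) (ℚₚ.+-inverseʳ y)) (ℚₚ.+-identityʳ x)))

-- `floor` works on the reduced numerator and denominator; cross-multiplication with x and d shows
-- that both fractions have the same integer quotient.
floor-÷ : ∀ x d .{{_ : NonZero d}} → floor (x ÷ d) ≡ + (x / d)
floor-÷ x (suc d) = unique (x ÷ suc d) (toℚᵘ-÷ x d)
  where
  unique : ∀ q → toℚᵘ q ≃ mkℚᵘ (+ x) d → floor q ≡ + (x / suc d)
  unique (mkℚ (+ k) e _) (*≡* eq) = trans (ℤᵐ.div-pos-is-/ℕ (+ k) (suc e)) (cong +_ (begin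
    k / suc e                            ≡⟨ m*n/o*n≡m/o k (suc d) (suc e) ⟨
    (k * suc d) / (suc e * suc d)        ≡⟨ /-congˡ {o = suc e * suc d} (ℤₚ.+-injective (trans (ℤₚ.pos-* k (suc d)) (trans eq (sym (ℤₚ.pos-* x (suc e)))))) ⟩
    (x * suc e) / (suc e * suc d)        ≡⟨ /-congʳ {suc e * suc d} {suc d * suc e} {x * suc e} (*-comm (suc e) (suc d)) ⟩
    (x * suc e) / (suc d * suc e)        ≡⟨ m*n/o*n≡m/o x (suc e) (suc d) ⟩
    x / suc d                            ∎))
    where open ≡-Reasoning
  unique (mkℚ -[1+ k ] e _) (*≡* eq) = contradiction (trans eq (sym (ℤₚ.pos-* x (suc e)))) λ ()

frac-÷ : ∀ x d .{{_ : NonZero d}} → frac (x ÷ d) ≡ (x % d) ÷ d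
frac-÷ x d = trans (cong (λ t → x ÷ d -ℚ (t ℚ./ 1)) (floor-÷ x d))
  (sym (+⇒- (trans (÷-+ (x % d) d (x / d) 1) (÷-cong _ (d * 1) x d {{m*n≢0 d 1}} eq))))
  where
  regroup : ∀ r q d → (r * 1 + q * d) * d ≡ (r + q * d) * (d * 1)
  regroup = solve-∀
  eq : (x % d * 1 + x / d * d) * d ≡ x * (d * 1)
  eq = trans (regroup (x % d) (x / d) d) (cong (_* (d * 1)) (sym (m≡m%n+[m/n]*n x d)))

÷-difference : ∀ N S c a h s z .{{_ : NonZero c}} .{{_ : NonZero h}} .{{_ : NonZero z}} →
  c * (h * z * N + a * s) ≡ h * z * S → N ÷ 1 ≡ (S ÷ c) -ℚ ((a ÷ h) *ℚ (s ÷ z))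
÷-difference N S c a h s z eq = +⇒- (begin
  N ÷ 1 +ℚ (a ÷ h) *ℚ (s ÷ z)                    ≡⟨ cong (N ÷ 1 +ℚ_) (÷-* a h s z) ⟩
  N ÷ 1 +ℚ (a * s) ÷ (h * z)                     ≡⟨ ÷-+ N 1 (a * s) (h * z) ⟩
  (N * (h * z) + a * s * 1) ÷ (1 * (h * z))      ≡⟨ ÷-cong _ _ S c (trans (regroup N h z a s c) (trans eq (regroup′ h z S))) ⟩
  S ÷ c                                          ∎)
  where
  open ≡-Reasoning
  instance
    hz≢0 : NonZero (h * z)
    hz≢0 = m*n≢0 h z
    1hz≢0 : NonZero (1 * (h * z))
    1hz≢0 = m*n≢0 1 (h * z)
  regroup : ∀ N h z a s c → (N * (h * z) + a * s * 1) * c ≡ c * (h * z * N + a * s)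
  regroup = solve-∀
  regroup′ : ∀ h z S → h * z * S ≡ S * (1 * (h * z))
  regroup′ = solve-∀

-- Case (i) uses h = 1 and s / z as fractional part, case (ii) h = 2, z = 1 and s as bracket. The
-- second formula follows from the first identity by Legendre's formula c E + S = A.
÷-differences : ∀ N E A S c a h s z .{{_ : NonZero c}} .{{_ : NonZero h}} .{{_ : NonZero z}} →
  c * E + S ≡ A → c * (h * z * (N + E) + a * s) ≡ h * z * A →
  (N ÷ 1 ≡ (A ÷ c) -ℚ ((a ÷ h) *ℚ (s ÷ z)) -ℚ (E ÷ 1)) × (N ÷ 1 ≡ (S ÷ c) -ℚ ((a ÷ h) *ℚ (s ÷ z)))
÷-differences N E A S c a h s z cE+S eq =
  +⇒- (trans (trans (÷-+ N 1 E 1) (cong (_÷ 1) (cong₂ _+_ (*-identityʳ N) (*-identityʳ E)))) (÷-difference (N + E) A c a h s z eq)) ,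
  ÷-difference N S c a h s z (+-cancelʳ-≡ (h * z * (c * E)) _ _ (begin
    c * (h * z * N + a * s) + h * z * (c * E)    ≡⟨ regroup c h z N a s E ⟩
    c * (h * z * (N + E) + a * s)                ≡⟨ eq ⟩
    h * z * A                                    ≡⟨ cong (h * z *_) cE+S ⟨
    h * z * (c * E + S)                          ≡⟨ regroup′ h z (c * E) S ⟩
    h * z * S + h * z * (c * E)                  ∎))
  where
  open ≡-Reasoning
  regroup : ∀ c h z N a s E → c * (h * z * N + a * s) + h * z * (c * E) ≡ c * (h * z * (N + E) + a * s)
  regroup = solve-∀
  regroup′ : ∀ h z x S → h * z * (x + S) ≡ h * z * S + h * z * x
  regroup′ = solve-∀

ℤ-difference : ∀ N E H Y δ → N + E + H ≡ Y + δ → + N ≡ + Y -ℤ + H -ℤ + E +ℤ + δ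
ℤ-difference N E H Y δ eq = begin
  + N                                        ≡⟨ regroup (+ N) (+ E) (+ H) ⟩
  + N +ℤ + E +ℤ + H -ℤ + H -ℤ + E            ≡⟨ cong (λ t → t -ℤ + H -ℤ + E) casts ⟩
  + Y +ℤ + δ -ℤ + H -ℤ + E                   ≡⟨ regroup′ (+ Y) (+ δ) (+ H) (+ E) ⟩
  + Y -ℤ + H -ℤ + E +ℤ + δ                   ∎
  where
  open ≡-Reasoning
  casts : + N +ℤ + E +ℤ + H ≡ + Y +ℤ + δ
  casts = trans (sym (trans (ℤₚ.pos-+ (N + E) H) (cong (_+ℤ + H) (ℤₚ.pos-+ N E)))) (trans (cong +_ eq) (ℤₚ.pos-+ Y δ))
  regroup : ∀ N E H → N ≡ N ℤ.+ E ℤ.+ H ℤ.- H ℤ.- E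
  regroup = ℤ-Solver.solve-∀
  regroup′ : ∀ Y δ H E → Y ℤ.+ δ ℤ.- H ℤ.- E ≡ Y ℤ.- H ℤ.- E ℤ.+ δ
  regroup′ = ℤ-Solver.solve-∀

-- The values of δ.

⌈v/2⌉≡⌊v/2⌋+parity : ∀ v → ⌈ v /2⌉ ≡ ⌊ v /2⌋ + [ ¬? (2 ∣? v) ]
⌈v/2⌉≡⌊v/2⌋+parity v = +-cancelˡ-≡ ⌊ v /2⌋ _ _ (trans (⌊n/2⌋+⌈n/2⌉≡n v)
  (trans (parity-decomposition v) (regroup ⌊ v /2⌋ [ ¬? (2 ∣? v) ])))
  where
  regroup : ∀ k b → k * 2 + b ≡ k + (k + b)
  regroup = solve-∀

module _ (k b f r s : ℕ) where

  private
    δ : ℕ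
    δ = (k + b * [ s <? r ] + [ r <? s ] * f) * [ ¬? (r ≟ s) ]

    brackets : ∀ {x y w} → [ s <? r ] ≡ x → [ r <? s ] ≡ y → [ ¬? (r ≟ s) ] ≡ w → δ ≡ (k + b * x + y * f) * w
    brackets refl refl refl = refl

  δ-≡ : r ≡ s → δ ≡ 0
  δ-≡ r≡s = trans (cong ((k + b * [ s <? r ] + [ r <? s ] * f) *_) ([]-no (¬? (r ≟ s)) (λ r≢s → r≢s r≡s))) (*-zeroʳ (k + b * [ s <? r ] + [ r <? s ] * f))

  δ-< : r < s → δ ≡ k + f
  δ-< r<s = trans (brackets ([]-no _ (<⇒≯ r<s)) ([]-yes _ r<s) ([]-yes _ (<⇒≢ r<s))) (regroup k b f)
    where
    regroup : ∀ k b f → (k + b * 0 + 1 * f) * 1 ≡ k + f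
    regroup = solve-∀

  δ-> : s < r → δ ≡ k + b
  δ-> s<r = trans (brackets ([]-yes _ s<r) ([]-no _ (<⇒≯ s<r)) ([]-yes _ (λ r≡s → <⇒≢ s<r (sym r≡s)))) (regroup k b f)
    where
    regroup : ∀ k b f → (k + b * 1 + 0 * f) * 1 ≡ k + b
    regroup = solve-∀

  -- The brackets of s < r and r < s already vanish when r = s, so multiplying them by the bracket
  -- of r ≠ s changes nothing.
  δ-distributed : k * [ ¬? (r ≟ s) ] + b * [ s <? r ] + [ r <? s ] * f ≡ δ
  δ-distributed with r ≟ s | s <? r | r <? s
  ... | yes refl | yes s<s | _ = contradiction s<s (<-irrefl refl)
  ... | yes refl | no _ | yes s<s = contradiction s<s (<-irrefl refl)
  ... | yes refl | no _ | no _ = regroup k b f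
    where
    regroup : ∀ k b f → k * 0 + b * 0 + 0 * f ≡ (k + b * 0 + 0 * f) * 0
    regroup = solve-∀
  ... | no _ | d | e = regroup k (b * [ d ]) ([ e ] * f)
    where
    regroup : ∀ k x y → k * 1 + x + y ≡ (k + x + y) * 1
    regroup = solve-∀

theorem12 : (p a n z : ℕ) → Prime p → p ≢ 2 → p ≢ 5 → 1 ≤ a → 1 ≤ n →
    IsRankOfAppearance p z →
    let v = ν p n
        r = (p ^ a * n) mod z
        s = n mod z
        A = (n * (p ^ a ∸ 1)) div (p ^ v * z)
        N = ν p (fibonomial (p ^ a * n) n)
        fr = frac (n ÷ (p ^ v * z))
        δ = (⌊ v /2⌋ + [ ¬? (2 ∣? v) ] * [ s <? r ] + [ r <? s ] * ν p (F z)) * [ ¬? (r ≟ s) ]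
    in ((p % 5 ≡ 1 ⊎ p % 5 ≡ 4) →
          (N ÷ 1 ≡ (A ÷ (p ∸ 1)) -ℚ ((a ÷ 1) *ℚ fr) -ℚ (ν p (A !) ÷ 1))
        × (N ÷ 1 ≡ (sp p A ÷ (p ∸ 1)) -ℚ ((a ÷ 1) *ℚ fr)))
     × ((p % 5 ≡ 2 ⊎ p % 5 ≡ 3) → 2 ∣ a →
          (N ÷ 1 ≡ (A ÷ (p ∸ 1)) -ℚ ((a ÷ 2) *ℚ ([ ¬? (s ≟ 0) ] ÷ 1)) -ℚ (ν p (A !) ÷ 1))
        × (N ÷ 1 ≡ (sp p A ÷ (p ∸ 1)) -ℚ ((a ÷ 2) *ℚ ([ ¬? (s ≟ 0) ] ÷ 1))))
     × ((p % 5 ≡ 2 ⊎ p % 5 ≡ 3) → ¬ (2 ∣ a) →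
          (+ N ≡ + (A div (p ∸ 1)) -ℤ + ((a ∸ 1) div 2 * [ ¬? (s ≟ 0) ]) -ℤ + ν p (A !) +ℤ + δ)
        × (r ≡ s → δ ≡ 0)
        × (r < s → δ ≡ ⌊ v /2⌋ + ν p (F z))
        × (s < r → δ ≡ ⌈ v /2⌉))
theorem12 p a n zero pp p≢2 p≢5 1≤a 1≤n (() , _)
-- With z a successor, `mod z` computes to `% z`, so the local `r` and `s` are those of the
-- statement.
theorem12 p a n z@(suc _) pp p≢2 p≢5 1≤a 1≤n rank = split A≡ fr≡ , inert-even A≡ , inert-odd A≡
  where
  instance
    p≢0 : NonZero p
    p≢0 = prime⇒nonZero pp
    p>1 : NonTrivial p
    p>1 = prime⇒nonTrivial pp
    n≢0 : NonZero n
    n≢0 = >-nonZero 1≤n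
    c≢0 : NonZero (p ∸ 1)
    c≢0 = >-nonZero (m<n⇒0<n∸m (nonTrivial⇒n>1 p))
  v c n′ A N E r s : ℕ
  v = ν p n
  c = p ∸ 1
  n′ = proj₁ (ν-spec pp n)
  A = (n′ * (p ^ a ∸ 1)) / z
  N = ν p (fibonomial (p ^ a * n) n)
  E = ν p (A !)
  r = (p ^ a * n) % z
  s = n % z
  instance
    pᵛ≢0 : NonZero (p ^ v)
    pᵛ≢0 = m^n≢0 p v
    pᵛz≢0 : NonZero (p ^ v * z)
    pᵛz≢0 = m*n≢0 (p ^ v) z
  n≡ : n ≡ p ^ v * n′
  n≡ = proj₁ (proj₂ (ν-spec pp n))
  A≡ : (n * (p ^ a ∸ 1)) div (p ^ v * z) ≡ A
  A≡ = trans (div≡/ _ (p ^ v * z)) (trans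
    (/-congˡ {o = p ^ v * z} (trans (cong (_* (p ^ a ∸ 1)) n≡) (*-assoc (p ^ v) n′ (p ^ a ∸ 1))))
    (m*n/m*o≡n/o (p ^ v) (n′ * (p ^ a ∸ 1)) z))
  fr≡ : frac (n ÷ (p ^ v * z)) ≡ (n′ % z) ÷ z
  fr≡ = trans (cong frac (÷-cong n (p ^ v * z) n′ z (trans (cong (_* z) n≡) (regroup (p ^ v) n′ z)))) (frac-÷ n′ z)
    where
    regroup : ∀ q n z → q * n * z ≡ n * (q * z)
    regroup = solve-∀

  -- The quotient in the statement equals the local `A` only propositionally. With a variable B in
  -- its place, matching on `refl` replaces all its occurrences at once.
  split : ∀ {B fr} → B ≡ A → fr ≡ (n′ % z) ÷ z → (p % 5 ≡ 1 ⊎ p % 5 ≡ 4) →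
      (N ÷ 1 ≡ (B ÷ c) -ℚ ((a ÷ 1) *ℚ fr) -ℚ (ν p (B !) ÷ 1))
    × (N ÷ 1 ≡ (sp p B ÷ c) -ℚ ((a ÷ 1) *ℚ fr))
  split refl refl p%5 = ÷-differences N E A (sp p A) c a 1 (n′ % z) z (legendre pp A)
    (subst (λ t → c * (t * (N + E) + a * (n′ % z)) ≡ t * A) (sym (*-identityˡ z))
      (ν-fibonomial-split pp p≢2 z rank a n n′ n≡ (rank-∣ pp rank (p ∸ 1) (p∣F[p-1] pp p≢2 p%5))))

  z∣1+p : (p % 5 ≡ 2 ⊎ p % 5 ≡ 3) → z ∣ suc p
  z∣1+p p%5 = rank-∣ pp rank (suc p) (p∣F[p+1] pp p≢2 p%5)

  inert-even : ∀ {B} → B ≡ A → (p % 5 ≡ 2 ⊎ p % 5 ≡ 3) → 2 ∣ a →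
      (N ÷ 1 ≡ (B ÷ c) -ℚ ((a ÷ 2) *ℚ ([ ¬? (s ≟ 0) ] ÷ 1)) -ℚ (ν p (B !) ÷ 1))
    × (N ÷ 1 ≡ (sp p B ÷ c) -ℚ ((a ÷ 2) *ℚ ([ ¬? (s ≟ 0) ] ÷ 1)))
  inert-even refl p%5 (divides h a≡) = ÷-differences N E A (sp p A) c a 2 [ ¬? (s ≟ 0) ] 1 (legendre pp A)
    (trans (cong (λ t → c * (2 * (N + E) + t * [ ¬? (s ≟ 0) ])) a≡)
      (trans (regroup c (N + E) h [ ¬? (s ≟ 0) ])
        (cong (2 *_) (ν-fibonomial-inert-even pp p≢2 z rank a n n′ n≡ (z∣1+p p%5) h a≡))))
    where
    regroup : ∀ c w h b → c * (2 * w + h * 2 * b) ≡ 2 * (c * (w + h * b))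
    regroup = solve-∀

  δ : ℕ
  δ = (⌊ v /2⌋ + [ ¬? (2 ∣? v) ] * [ s <? r ] + [ r <? s ] * ν p (F z)) * [ ¬? (r ≟ s) ]

  inert-odd : ∀ {B} → B ≡ A → (p % 5 ≡ 2 ⊎ p % 5 ≡ 3) → ¬ (2 ∣ a) →
      (+ N ≡ + (B div c) -ℤ + ((a ∸ 1) div 2 * [ ¬? (s ≟ 0) ]) -ℤ + ν p (B !) +ℤ + δ)
    × (r ≡ s → δ ≡ 0)
    × (r < s → δ ≡ ⌊ v /2⌋ + ν p (F z))
    × (s < r → δ ≡ ⌈ v /2⌉)
  inert-odd refl p%5 ¬2∣a =
    ℤ-difference N E ((a ∸ 1) / 2 * [ ¬? (s ≟ 0) ]) (A div c) δ
      (trans (ν-fibonomial-inert-odd pp p≢2 z rank a n n′ n≡ (z∣1+p p%5) ((a ∸ 1) / 2) a≡)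
        (cong₂ _+_ (sym (div≡/ A c)) (δ-distributed ⌊ v /2⌋ [ ¬? (2 ∣? v) ] (ν p (F z)) r s))) ,
    δ-≡ ⌊ v /2⌋ [ ¬? (2 ∣? v) ] (ν p (F z)) r s ,
    δ-< ⌊ v /2⌋ [ ¬? (2 ∣? v) ] (ν p (F z)) r s ,
    λ s<r → trans (δ-> ⌊ v /2⌋ [ ¬? (2 ∣? v) ] (ν p (F z)) r s s<r) (sym (⌈v/2⌉≡⌊v/2⌋+parity v))
    where
    h≡ : (a ∸ 1) / 2 ≡ ⌊ a /2⌋
    h≡ = trans (cong (λ t → (t ∸ 1) / 2) (odd-decomposition a ¬2∣a))
      (trans (cong (_/ 2) (m+n∸n≡m (⌊ a /2⌋ * 2) 1)) (m*n/n≡m ⌊ a /2⌋ 2))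
    a≡ : a ≡ (a ∸ 1) / 2 * 2 + 1
    a≡ = trans (odd-decomposition a ¬2∣a) (cong (λ t → t * 2 + 1) (sym h≡))
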